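{- Let $\mathcal{A}$ be a simple central maxout arrangement of $m$ maxout units of ranks $k_1,\dots,k_m\ge2$ in $\mathbb{R}^{n+1}$ with $m\ge n+1$, where for each unit the linear functions are not all equal. Then $$r(\mathcal{A})=\binom{m-1}{n}+\sum_{j=0}^{n}(-1)^{n-j}\binom{m-1-j}{n-j}\sum_{S\in\binom{[m]}{j}}r(\mathcal{A}_S).$$
   Context: Central maxout arrangement in $\mathbb{R}^{n+1}$: given $m$ maxout units $z_i(x)=\max\{A_{i,1}(x),\dots,A_{i,k_i}(x)\}$, $x\in\mathbb{R}^{n+1}$, with linear functions $A_{i,a}$, the arrangement is $\mathcal{A}=\{H^i_{ab}: i\in[m],\{a,b\}\in\binom{[k_i]}{2},\ \operatorname{codim}H^i_{ab}=1\}$, where $H^i_{ab}=\{x: A_{i,a}(x)=A_{i,b}(x)=\max_{c\in[k_i]}A_{i,c}(x)\}$. Its elements are called atoms. For $S\subseteq[m]$, $\mathcal{A}_S$ is the sub-arrangement of atoms of units $i\in S$ ($\mathcal{A}_\emptyset$ is empty). $r(\mathcal{A})$ is the number of connected components of $\mathbb{R}^{n+1}\setminus\bigcup_{H\in\mathcal{A}}H$, so $r(\mathcal{A}_\emptyset)=1$. A central maxout arrangement is simple if, for every $j$, the intersection of any $j$ atoms of (pairwise) different units is either $\{0\}$ or has codimension $j$. $[m]=\{1,\dots,m\}$ and $\binom{[m]}{j}$ is the set of $j$-element subsets of $[m]$. -}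

module Defs where

open import Algebra.Bundles using (CommutativeRing)
open import Algebra.Module.Bundles.Raw using (RawLeftModule)
import Algebra.Module.Construct.TensorUnit as TensorUnit
open import Algebra.Module.Morphism.Structures using (module LeftModuleMorphisms)
import Algebra.Properties.Semiring.Sum as SemiringSum
open import Data.Fin.Base using (Fin)
import Data.Fin.Permutation as Permutation
open import Data.Fin.Subset using (Subset; inside; outside; ∣_∣)
  renaming (_∈_ to _∈ₛ_)
open import Data.List.Base using (List; []; _∷_; _++_; map; filter)
open import Data.Nat.Base using (ℕ; zero; suc)
import Data.Nat.Base as ℕ
import Data.Nat.Properties as ℕ
open import Data.Product.Base using (Σ; ∃; ∃-syntax; _×_; _,_; proj₁)
open import Data.Sum.Base using (_⊎_; inj₁; inj₂)
import Data.Vec.Base as Vec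
open import Data.Vec.Functional using (Vector)
open import Function.Base using (_∘_; _on_)
open import Function.Bundles using (Inverse)
import Function.Construct.Composition as Composition
import Function.Construct.Symmetry as Symmetry
open import Function.Definitions using (Injective)
open import Level using (0ℓ) renaming (suc to lsuc)
open import Relation.Binary.Bundles using (Setoid)
open import Relation.Binary.Core using (Rel)
open import Relation.Binary.Structures using (IsTotalOrder)
open import Relation.Binary.PropositionalEquality.Core using (_≡_; _≢_)
open import Relation.Binary.PropositionalEquality.Properties using () renaming (setoid to ≡-setoid)
open import Relation.Nullary.Negation using (¬_; contradiction)
open import Relation.Unary using (Pred; _∈_; _⊆_; _≐_; _∪_; ∁; ⋂; Satisfiable)

-- The real numbers are axiomatised up to isomorphism: a model of ℝ is a
-- Dedekind-complete totally ordered field.  Totality of the order and the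
-- supremum axiom have their classical force; the structure is meant to be used
-- together with excluded middle.
record CompleteOrderedField : Set₁ where
  field
    commutativeRing : CommutativeRing 0ℓ 0ℓ

  open CommutativeRing commutativeRing public

  infix 4 _≤_ _<_

  field
    0≉1          : ¬ (0# ≈ 1#)
    inverse      : ∀ x → ¬ (x ≈ 0#) → ∃[ y ] x * y ≈ 1#
    _≤_          : Rel Carrier 0ℓ
    isTotalOrder : IsTotalOrder _≈_ _≤_
    +-monoʳ-≤    : ∀ x {y z} → y ≤ z → (x + y) ≤ (x + z)
    *-nonneg     : ∀ {x y} → 0# ≤ x → 0# ≤ y → 0# ≤ (x * y)

  UpperBound : Pred Carrier 0ℓ → Pred Carrier 0ℓ
  UpperBound P u = ∀ {x} → x ∈ P → x ≤ u

  field
    supremum : ∀ (P : Pred Carrier 0ℓ) → Satisfiable P → Satisfiable (UpperBound P) →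
               ∃[ s ] UpperBound P s × (∀ u → UpperBound P u → s ≤ u)

  _<_ : Rel Carrier 0ℓ
  x < y = x ≤ y × ¬ (x ≈ y)

-- All subsets of [m], each listed exactly once.
subsets : ∀ m → List (Subset m)
subsets zero    = Vec.[] ∷ []
subsets (suc m) = map (Vec._∷_ outside) (subsets m) ++ map (Vec._∷_ inside) (subsets m)

subsetsOfSize : ∀ m → ℕ → List (Subset m)
subsetsOfSize m j = filter (λ S → ∣ S ∣ ℕ.≟ j) (subsets m)

HasCardinality : ∀ {a ℓ} → Setoid a ℓ → ℕ → Set _
HasCardinality X k = Inverse X (≡-setoid (Fin k))

cardinality-unique : ∀ {a ℓ} (X : Setoid a ℓ) {k l} →
                     HasCardinality X k → HasCardinality X l → k ≡ l
cardinality-unique X f g =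
  Permutation.↔⇒≡ (Composition.inverse (Symmetry.inverse f) g)

module Euclidean (ℝ : CompleteOrderedField) (d : ℕ) where
  open CompleteOrderedField ℝ
  open SemiringSum semiring using (sum)

  Point : Set
  Point = Vector Carrier d

  infix 4 _≋_
  _≋_ : Rel Point 0ℓ
  x ≋ y = ∀ t → x t ≈ y t

  0ᵛ : Point
  0ᵛ _ = 0#

  rawLeftModule : RawLeftModule Carrier 0ℓ 0ℓ
  rawLeftModule = record
    { Carrierᴹ = Point
    ; _≈ᴹ_     = _≋_
    ; _+ᴹ_     = λ x y t → x t + y t
    ; _*ₗ_     = λ c x t → c * x t
    ; 0ᴹ       = 0ᵛ
    ; -ᴹ_      = λ x t → - x t
    }

  record LinearFunction : Set where
    field
      ⟦_⟧      : Point → Carrier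
      isLinear : LeftModuleMorphisms.IsLeftModuleHomomorphism
                   rawLeftModule (TensorUnit.rawLeftModule {R = rawRing}) ⟦_⟧

  open LinearFunction public using (⟦_⟧)

  linearCombination : ∀ {p} → Vector Carrier p → Vector Point p → Point
  linearCombination c v t = sum (λ i → c i * v i t)

  Span : Pred Point 0ℓ → Pred Point 0ℓ
  Span P x = ∃[ p ] Σ (Vector Carrier p) λ c → Σ (Vector Point p) λ v →
             (∀ i → v i ∈ P) × x ≋ linearCombination c v

  LinearlyIndependent : ∀ {p} → Vector Point p → Set
  LinearlyIndependent v =
    ∀ c → linearCombination c v ≋ 0ᵛ → ∀ i → c i ≈ 0#

  -- The dimension of a set is that of its affine hull; for a set containing 0,
  -- which is the only case used, that is its linear span.
  HasDimension : Pred Point 0ℓ → ℕ → Set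
  HasDimension P e = Σ (Vector Point e) λ b →
    (∀ i → b i ∈ Span P) × LinearlyIndependent b ×
    (∀ {x} → x ∈ Span P → ∃[ c ] x ≋ linearCombination c b)

  HasCodimension : Pred Point 0ℓ → ℕ → Set
  HasCodimension P c = ∃[ e ] HasDimension P e × e ℕ.+ c ≡ d

  Ball : Point → Carrier → Pred Point 0ℓ
  Ball x ε y = ∀ t → (x t - ε) < y t × y t < (x t + ε)

  -- The maximum norm induces the Euclidean topology.
  Open : Pred Point 0ℓ → Set
  Open U = ∀ {x} → x ∈ U → ∃[ ε ] 0# < ε × Ball x ε ⊆ U

  Connected : Pred Point 0ℓ → Set₁
  Connected C = ∀ (U V : Pred Point 0ℓ) → Open U → Open V → C ⊆ U ∪ V →
    ¬ (∃[ x ] x ∈ C × x ∈ U × x ∈ V) →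
    ¬ ((∃[ x ] x ∈ C × x ∈ U) × (∃[ x ] x ∈ C × x ∈ V))

  SameComponent : Pred Point 0ℓ → Rel Point (lsuc 0ℓ)
  SameComponent X x y = ∃[ C ] Connected C × C ⊆ X × x ∈ C × y ∈ C

  private
    singleton-connected : ∀ x → Connected (x ≡_)
    singleton-connected x U V _ _ _ disjoint
      ((_ , _≡_.refl , x∈U) , (_ , _≡_.refl , x∈V)) = disjoint (x , _≡_.refl , x∈U , x∈V)

    ∪-connected : ∀ {C D y} → Connected C → Connected D → y ∈ C → y ∈ D → Connected (C ∪ D)
    ∪-connected {C} {D} {y} conC conD y∈C y∈D U V oU oV cover disjoint (meetsU , meetsV) =
      go (cover (inj₁ y∈C)) meetsU meetsV
      where
      noC : ¬ ((∃[ x ] x ∈ C × x ∈ U) × (∃[ x ] x ∈ C × x ∈ V))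
      noC = conC U V oU oV (cover ∘ inj₁) (λ (x , x∈C , x∈UV) → disjoint (x , inj₁ x∈C , x∈UV))
      noD : ¬ ((∃[ x ] x ∈ D × x ∈ U) × (∃[ x ] x ∈ D × x ∈ V))
      noD = conD U V oU oV (cover ∘ inj₂) (λ (x , x∈D , x∈UV) → disjoint (x , inj₂ x∈D , x∈UV))
      go : y ∈ U ⊎ y ∈ V → (∃[ x ] x ∈ C ∪ D × x ∈ U) → ¬ (∃[ x ] x ∈ C ∪ D × x ∈ V)
      go (inj₁ y∈U) _ (x , inj₁ x∈C , x∈V) = noC ((y , y∈C , y∈U) , (x , x∈C , x∈V))
      go (inj₁ y∈U) _ (x , inj₂ x∈D , x∈V) = noD ((y , y∈D , y∈U) , (x , x∈D , x∈V))
      go (inj₂ y∈V) (x , inj₁ x∈C , x∈U) _ = noC ((x , x∈C , x∈U) , (y , y∈C , y∈V))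
      go (inj₂ y∈V) (x , inj₂ x∈D , x∈U) _ = noD ((x , x∈D , x∈U) , (y , y∈D , y∈V))

  -- The setoid whose equivalence classes are the connected components of X.
  components : Pred Point 0ℓ → Setoid 0ℓ (lsuc 0ℓ)
  components X = record
    { Carrier       = Σ Point X
    ; _≈_           = SameComponent X on proj₁
    ; isEquivalence = record
      { refl  = λ {(x , x∈X)} →
                (x ≡_) , singleton-connected x , (λ { _≡_.refl → x∈X }) , _≡_.refl , _≡_.refl
      ; sym   = λ (C , con , C⊆X , x∈C , y∈C) → C , con , C⊆X , y∈C , x∈C
      ; trans = λ (C , conC , C⊆X , x∈C , y∈C) (D , conD , D⊆X , y∈D , z∈D) →
                C ∪ D , ∪-connected conC conD y∈C y∈D
                , (λ { (inj₁ p) → C⊆X p ; (inj₂ p) → D⊆X p }) , inj₁ x∈C , inj₂ z∈D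
      }
    }

module MaxoutArrangement (ℝ : CompleteOrderedField) {d m : ℕ} {k : Fin m → ℕ}
  (A : ∀ i → Fin (k i) → Euclidean.LinearFunction ℝ d) where
  open CompleteOrderedField ℝ using (_≈_; _≤_)
  open Euclidean ℝ d

  H : ∀ i → Fin (k i) → Fin (k i) → Pred Point 0ℓ
  H i a b x = ⟦ A i a ⟧ x ≈ ⟦ A i b ⟧ x × (∀ c → ⟦ A i c ⟧ x ≤ ⟦ A i a ⟧ x)

  IsAtom : ∀ i → Fin (k i) → Fin (k i) → Set
  IsAtom i a b = a ≢ b × HasCodimension (H i a b) 1

  NotAllEqual : Fin m → Set
  NotAllEqual i = ¬ (∀ a b x → ⟦ A i a ⟧ x ≈ ⟦ A i b ⟧ x)

  Simple : Set
  Simple = ∀ j (u : Fin j → Fin m) → Injective _≡_ _≡_ u →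
    ∀ (a b : ∀ s → Fin (k (u s))) → (∀ s → IsAtom (u s) (a s) (b s)) →
    (⋂ (Fin j) λ s → H (u s) (a s) (b s)) ≐ (_≋ 0ᵛ)
    ⊎ HasCodimension (⋂ (Fin j) λ s → H (u s) (a s) (b s)) j

  -- The union of the atoms of the units in S.
  support : Subset m → Pred Point 0ℓ
  support S x = ∃[ i ] i ∈ₛ S × ∃[ a ] ∃[ b ] IsAtom i a b × x ∈ H i a b

  -- NumberOfRegions S q expresses r(𝒜_S) = q; at most one q satisfies it, by
  -- cardinality-unique.
  NumberOfRegions : Subset m → ℕ → Set₁
  NumberOfRegions S = HasCardinality (components (∁ (support S)))

{-# OPTIONS --safe #-}
module Submission where

-- The number of regions is an Euler characteristic.  Call a unit smooth at x if
-- all its functions that are maximal at x coincide; the support of 𝒜_S is the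
-- set of points at which some unit of S is not smooth (a polyhedral complex is
-- pure, so its points lie on facets), and its complement is a disjoint union of
-- r(𝒜_S) convex open sets.  If a combination Σ c_j 1[U_j] of indicators of
-- nonempty convex open sets of ℝᵈ equals e 1[p] for a point p, then
-- Σ c_j = (−1)ᵈ e: the slices with a fixed first coordinate reduce the claim, by
-- induction on d, to the projections to the first coordinate, and on the line
-- each interval has exactly one right endpoint, at which its indicator jumps.
-- Apply this to r replaced by S ↦ 1[complement of the support of 𝒜_S] in the
-- formula.  If exactly p units are smooth at x, then Σ over |S| = j of these
-- indicators is the binomial coefficient of p over j; simplicity makes p ≥ m − n
-- away from the origin, where the defect of the formula vanishes by
-- Vandermonde's convolution, and p = 0 at the origin, where the defect is
-- (−1)ⁿ⁺¹ times the binomial coefficient of m − 1 over n.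

open import Defs
open import Algebra.Bundles using (CommutativeRing; RawRing)
import Algebra.Module.Morphism.Structures as ModuleMorphisms
import Algebra.Properties.AbelianGroup as AbelianGroupProperties
import Algebra.Properties.CommutativeSemigroup as CommutativeSemigroupProperties
import Algebra.Properties.Ring as RingProperties
import Algebra.Properties.Semiring.Mult.TCOptimised as SemiringMult
import Algebra.Properties.Semiring.Sum as SemiringSum
import Algebra.Solver.Ring as RingSolver
open import Algebra.Solver.Ring.AlmostCommutativeRing
  using (AlmostCommutativeRing; fromCommutativeRing; _-Raw-AlmostCommutative⟶_)
open import Axiom.ExcludedMiddle using (ExcludedMiddle)
open import Data.Bool.Base using (true; false)
open import Data.Empty using (⊥-elim)
open import Data.Fin.Base using (Fin; zero; suc; toℕ; fromℕ<; combine; remQuot; punchIn; punchOut)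
import Data.Fin.Properties as Fin
open import Data.Fin.Subset as Subset using (Subset; inside; outside; ∣_∣) renaming (_∈_ to _∈ₛ_)
import Data.Fin.Subset.Properties as Subset
open import Data.Integer.Base as ℤ using (ℤ; 0ℤ; 1ℤ; -1ℤ)
import Data.Integer.Properties as ℤ
open import Data.Integer.Tactic.RingSolver using () renaming (solve-∀ to solveℤ-∀)
open import Data.List.Base as List using (List; []; _∷_; _++_; map; filter; foldr; length)
import Data.List.Properties as List
open import Data.Maybe.Base using (Maybe; just; nothing)
open import Data.Maybe.Relation.Binary.Pointwise as Pointwise using (Pointwise; just; nothing)
open import Data.Nat.Base as ℕ using (ℕ; zero; suc)
open import Data.Nat.Combinatorics using (_C_; nCk+nC[k+1]≡[n+1]C[k+1]; k>n⇒nCk≡0; nCn≡1; nCk≡nC[n∸k])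
import Data.Nat.ListAction as ℕList
import Data.Nat.Properties as ℕ
open import Data.Product.Base using (Σ; ∃; ∃-syntax; _×_; _,_; proj₁; proj₂)
open import Data.Sum.Base using (_⊎_; inj₁; inj₂; [_,_]′)
import Data.Unit.Base as Unit
open import Data.Vec.Base using (here; there) renaming (_∷_ to _∷ₛ_; [] to []ₛ)
open import Data.Vec.Functional using (Vector; tail) renaming (_∷_ to _∷ᵛ_; [] to []ᵛ)
open import Function.Base using (_∘_; id)
open import Function.Definitions using (Injective)
open import Level using (0ℓ; Lift; lift; lower) renaming (suc to lsuc)
open import Relation.Binary.Bundles using (Setoid)
open import Relation.Binary.PropositionalEquality.Core as ≡ using (_≡_; _≢_)
open import Relation.Binary.PropositionalEquality.Properties using (module ≡-Reasoning)
open import Relation.Binary.Structures using (IsTotalOrder)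
open import Relation.Nullary.Decidable using (Dec; yes; no; does; map′)
open import Relation.Nullary.Negation using (¬_; contradiction)
open import Relation.Unary using (Pred; _∩_; _⊆_; _≐_; U; ∁; Satisfiable)

-- With compact supports an open convex cell of ℝᵈ has Euler characteristic (-1)ᵈ and a point has 1.
-- Multiplying by (-1)ᵈ makes every cell count 1, so that counting regions is integrating, and moves
-- the sign to the point. The gain is that the lower-dimensional faces of the arrangement and their
-- incidences never appear: the formula is checked one point at a time. No integral is constructed
-- as a function: an integral is a formal derivation of a value, and multiples of point indicators
-- are the only functions whose value has to be shown independent of the derivation. The geometric
-- obstacle is that atoms are by definition only the tie sets of codimension one. At a point several
-- functions may tie, some may be copies of each other and differences may be proportional, so an
-- arbitrary tying pair need not give an atom. The generic choices in `facet` single out a pair that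
-- does.

private
  module ℤSum = SemiringSum ℤ.+-*-semiring

-- Ring identities over a commutative ring, with integer coefficients

module IntegerSolver {c ℓ} (R : CommutativeRing c ℓ) where
  open CommutativeRing R hiding (zero)
  open SemiringMult semiring using (×1-homo-*; ×-homo-+; 1+×) renaming (_×_ to _⊠_)
  open RingProperties ring using (-0#≈0#; x[y-z]≈xy-xz; [y-z]x≈yx-zx)
  open AbelianGroupProperties +-abelianGroup using (⁻¹-∙-comm; ⁻¹-anti-homo‿-)
  open CommutativeSemigroupProperties +-commutativeSemigroup using (interchange)
  open import Relation.Binary.Reasoning.Setoid setoid

  private
    almost : AlmostCommutativeRing c ℓ
    almost = fromCommutativeRing R

    reduce : ℕ → ℕ → ℕ × ℕ
    reduce zero    b       = zero , b
    reduce (suc a) zero    = suc a , zero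
    reduce (suc a) (suc b) = reduce a b

    -- The pair (a , b) stands for the integer a − b.  The solver compares
    -- normal forms syntactically, so differences have to be kept reduced.
    differences : RawRing 0ℓ 0ℓ
    differences = record
      { Carrier = ℕ × ℕ
      ; _≈_     = _≡_
      ; _+_     = λ (a , b) (c , d) → reduce (a ℕ.+ c) (b ℕ.+ d)
      ; _*_     = λ (a , b) (c , d) → reduce (a ℕ.* c ℕ.+ b ℕ.* d) (a ℕ.* d ℕ.+ b ℕ.* c)
      ; -_      = λ (a , b) → b , a
      ; 0#      = 0 , 0
      ; 1#      = 1 , 0
      }

    -- The clause for `zero` makes `:0` and `:1` evaluate definitionally to `0#` and `1#`, so that
    -- solved equations match the goals as written.
    embed : ℕ × ℕ → Carrier
    embed (a , zero)  = a ⊠ 1#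
    embed (a , suc b) = a ⊠ 1# - suc b ⊠ 1#

    embed-difference : ∀ a b → embed (a , b) ≈ a ⊠ 1# - b ⊠ 1#
    embed-difference a zero    = sym (trans (+-congˡ -0#≈0#) (+-identityʳ _))
    embed-difference a (suc b) = refl

    +*-homo : ∀ a b c d → (a ℕ.* b ℕ.+ c ℕ.* d) ⊠ 1# ≈ (a ⊠ 1#) * (b ⊠ 1#) + (c ⊠ 1#) * (d ⊠ 1#)
    +*-homo a b c d = trans (×-homo-+ 1# (a ℕ.* b) (c ℕ.* d)) (+-cong (×1-homo-* a b) (×1-homo-* c d))

    difference-+ : ∀ a c b d → (a + c) - (b + d) ≈ (a - b) + (c - d)
    difference-+ a c b d = trans (+-congˡ (sym (⁻¹-∙-comm b d))) (interchange a c (- b) (- d))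

    shift : ∀ x y z → x - y ≈ (x + z) - (y + z)
    shift x y z = begin
      x - y               ≈⟨ +-identityʳ _ ⟨
      (x - y) + 0#        ≈⟨ +-congˡ (-‿inverseʳ z) ⟨
      (x - y) + (z - z)   ≈⟨ difference-+ x z y z ⟨
      (x + z) - (y + z)   ∎

    embed-reduce : ∀ a b → embed (reduce a b) ≈ a ⊠ 1# - b ⊠ 1#
    embed-reduce zero    b       = embed-difference zero b
    embed-reduce (suc a) zero    = embed-difference (suc a) zero
    embed-reduce (suc a) (suc b) = begin
      embed (reduce a b)                ≈⟨ embed-reduce a b ⟩
      a ⊠ 1# - b ⊠ 1#                   ≈⟨ shift _ _ 1# ⟩
      (a ⊠ 1# + 1#) - (b ⊠ 1# + 1#)     ≈⟨ +-cong (suc-⊠ a) (-‿cong (suc-⊠ b)) ⟨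
      suc a ⊠ 1# - suc b ⊠ 1#           ∎
      where
      suc-⊠ : ∀ a → suc a ⊠ 1# ≈ a ⊠ 1# + 1#
      suc-⊠ a = trans (1+× a 1#) (+-comm 1# _)

    *-difference : ∀ a b c d → (a - b) * (c - d) ≈ (a * c + b * d) - (a * d + b * c)
    *-difference a b c d = begin
      (a - b) * (c - d)                          ≈⟨ [y-z]x≈yx-zx (c - d) a b ⟩
      a * (c - d) - b * (c - d)                  ≈⟨ +-cong (x[y-z]≈xy-xz a c d) (-‿cong (x[y-z]≈xy-xz b c d)) ⟩
      (a * c - a * d) - (b * c - b * d)          ≈⟨ +-congˡ (⁻¹-anti-homo‿- (b * c) (b * d)) ⟩
      (a * c - a * d) + (b * d - b * c)          ≈⟨ interchange (a * c) (- (a * d)) (b * d) (- (b * c)) ⟩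
      (a * c + b * d) + (- (a * d) - b * c)      ≈⟨ +-congˡ (⁻¹-∙-comm (a * d) (b * c)) ⟩
      (a * c + b * d) - (a * d + b * c)          ∎

    morphism : differences -Raw-AlmostCommutative⟶ almost
    morphism = record
      { ⟦_⟧    = embed
      ; +-homo = λ (a , b) (c , d) → begin
          embed (reduce (a ℕ.+ c) (b ℕ.+ d))               ≈⟨ embed-reduce (a ℕ.+ c) (b ℕ.+ d) ⟩
          (a ℕ.+ c) ⊠ 1# - (b ℕ.+ d) ⊠ 1#                  ≈⟨ +-cong (×-homo-+ 1# a c) (-‿cong (×-homo-+ 1# b d)) ⟩
          (a ⊠ 1# + c ⊠ 1#) - (b ⊠ 1# + d ⊠ 1#)            ≈⟨ difference-+ _ _ _ _ ⟩
          (a ⊠ 1# - b ⊠ 1#) + (c ⊠ 1# - d ⊠ 1#)            ≈⟨ +-cong (embed-difference a b) (embed-difference c d) ⟨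
          embed (a , b) + embed (c , d)                    ∎
      ; *-homo = λ (a , b) (c , d) → begin
          embed (reduce (a ℕ.* c ℕ.+ b ℕ.* d) (a ℕ.* d ℕ.+ b ℕ.* c))
            ≈⟨ embed-reduce (a ℕ.* c ℕ.+ b ℕ.* d) (a ℕ.* d ℕ.+ b ℕ.* c) ⟩
          (a ℕ.* c ℕ.+ b ℕ.* d) ⊠ 1# - (a ℕ.* d ℕ.+ b ℕ.* c) ⊠ 1#
            ≈⟨ +-cong (+*-homo a c b d) (-‿cong (+*-homo a d b c)) ⟩
          ((a ⊠ 1#) * (c ⊠ 1#) + (b ⊠ 1#) * (d ⊠ 1#)) - ((a ⊠ 1#) * (d ⊠ 1#) + (b ⊠ 1#) * (c ⊠ 1#))
            ≈⟨ *-difference _ _ _ _ ⟨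
          (a ⊠ 1# - b ⊠ 1#) * (c ⊠ 1# - d ⊠ 1#)
            ≈⟨ *-cong (embed-difference a b) (embed-difference c d) ⟨
          embed (a , b) * embed (c , d) ∎
      ; -‿homo = λ (a , b) → begin
          embed (b , a)          ≈⟨ embed-difference b a ⟩
          b ⊠ 1# - a ⊠ 1#        ≈⟨ ⁻¹-anti-homo‿- _ _ ⟨
          - (a ⊠ 1# - b ⊠ 1#)    ≈⟨ -‿cong (embed-difference a b) ⟨
          - embed (a , b)        ∎
      ; 0-homo = refl
      ; 1-homo = refl
      }

    _≟_ : ∀ x y → Maybe (embed x ≈ embed y)
    (a , b) ≟ (c , d) with a ℕ.+ d ℕ.≟ c ℕ.+ b
    ... | no _   = nothing
    ... | yes eq = just (begin
      embed (a , b)                             ≈⟨ embed-difference a b ⟩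
      a ⊠ 1# - b ⊠ 1#                           ≈⟨ shift _ _ _ ⟩
      (a ⊠ 1# + d ⊠ 1#) - (b ⊠ 1# + d ⊠ 1#)     ≈⟨ +-congʳ (×-homo-+ 1# a d) ⟨
      (a ℕ.+ d) ⊠ 1# - (b ⊠ 1# + d ⊠ 1#)        ≡⟨ ≡.cong (λ e → e ⊠ 1# - (b ⊠ 1# + d ⊠ 1#)) eq ⟩
      (c ℕ.+ b) ⊠ 1# - (b ⊠ 1# + d ⊠ 1#)        ≈⟨ +-cong (×-homo-+ 1# c b) (-‿cong (+-comm _ _)) ⟩
      (c ⊠ 1# + b ⊠ 1#) - (d ⊠ 1# + b ⊠ 1#)     ≈⟨ shift _ _ _ ⟨
      c ⊠ 1# - d ⊠ 1#                           ≈⟨ embed-difference c d ⟨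
      embed (c , d)                             ∎)

  open RingSolver differences almost morphism _≟_ public
    using (solve; _:=_; _:+_; _:*_; _:-_; :-_; con; Polynomial)

  :0 :1 : ∀ {n} → Polynomial n
  :0 = con (0 , 0)
  :1 = con (1 , 0)

-- Classical ordered-field arithmetic

module Reals (em : ExcludedMiddle (lsuc 0ℓ)) (ℝ : CompleteOrderedField) where
  open CompleteOrderedField ℝ hiding (zero)
  open IsTotalOrder isTotalOrder using (total; antisym)
    renaming (reflexive to ≤-reflexive; refl to ≤-refl; trans to ≤-trans; ≤-respˡ-≈ to ≤-respˡ;
             ≤-respʳ-≈ to ≤-respʳ) public
  open IntegerSolver commutativeRing public

  opaque
    dec : (P : Set) → Dec P
    dec P = map′ lower lift (em {Lift (lsuc 0ℓ) P})

    by-contradiction : ∀ {P : Set} → ¬ ¬ P → P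
    by-contradiction {P} ¬¬p with dec P
    ... | yes p = p
    ... | no ¬p = contradiction ¬p ¬¬p

    not-all : ∀ {A : Set} {P : A → Set} → ¬ (∀ a → P a) → ∃[ a ] ¬ P a
    not-all ¬∀ = by-contradiction λ ¬∃ → ¬∀ λ a → by-contradiction λ ¬p → ¬∃ (a , ¬p)

    ≤⇒0≤ : ∀ {x y} → x ≤ y → 0# ≤ y - x
    ≤⇒0≤ {x} {y} x≤y = ≤-respˡ (-‿inverseˡ x) (≤-respʳ (+-comm _ _) (+-monoʳ-≤ (- x) x≤y))

    0≤⇒≤ : ∀ {x y} → 0# ≤ y - x → x ≤ y
    0≤⇒≤ {x} {y} p = ≤-respˡ (+-identityʳ x)
      (≤-respʳ (solve 2 (λ x y → x :+ (y :- x) := y) refl x y) (+-monoʳ-≤ x p))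

    <-respˡ : ∀ {x y z} → x ≈ y → x < z → y < z
    <-respˡ x≈y (x≤z , x≉z) = ≤-respˡ x≈y x≤z , λ y≈z → x≉z (trans x≈y y≈z)

    <-respʳ : ∀ {x y z} → y ≈ z → x < y → x < z
    <-respʳ y≈z (x≤y , x≉y) = ≤-respʳ y≈z x≤y , λ x≈z → x≉y (trans x≈z (sym y≈z))

    <⇒0< : ∀ {x y} → x < y → 0# < y - x
    <⇒0< {x} {y} (x≤y , x≉y) = ≤⇒0≤ x≤y , λ 0≈ → x≉y (begin
      x             ≈⟨ +-identityʳ x ⟨
      x + 0#        ≈⟨ +-congˡ 0≈ ⟩
      x + (y - x)   ≈⟨ solve 2 (λ x y → x :+ (y :- x) := y) refl x y ⟩
      y             ∎)
      where open import Relation.Binary.Reasoning.Setoid setoid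

    0<⇒< : ∀ {x y} → 0# < y - x → x < y
    0<⇒< {x} {y} (p , ≉) = 0≤⇒≤ p , λ x≈y → ≉ (sym (trans (+-congˡ (-‿cong x≈y)) (-‿inverseʳ y)))

    <-irrefl : ∀ {x y} → x ≈ y → ¬ (x < y)
    <-irrefl x≈y (_ , x≉y) = x≉y x≈y

    ≤-<-trans : ∀ {x y z} → x ≤ y → y < z → x < z
    ≤-<-trans x≤y (y≤z , y≉z) = ≤-trans x≤y y≤z , λ x≈z → y≉z (antisym y≤z (≤-respˡ x≈z x≤y))

    <-≤-trans : ∀ {x y z} → x < y → y ≤ z → x < z
    <-≤-trans (x≤y , x≉y) y≤z = ≤-trans x≤y y≤z , λ x≈z → x≉y (antisym x≤y (≤-respʳ (sym x≈z) y≤z))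

    <-trans : ∀ {x y z} → x < y → y < z → x < z
    <-trans x<y (y≤z , _) = <-≤-trans x<y y≤z

    <⇒≱ : ∀ {x y} → x < y → ¬ (y ≤ x)
    <⇒≱ x<y y≤x = <-irrefl refl (<-≤-trans x<y y≤x)

    ≤-<-total : ∀ x y → x ≤ y ⊎ y < x
    ≤-<-total x y with dec (x ≤ y)
    ... | yes x≤y = inj₁ x≤y
    ... | no  x≰y with total x y
    ...   | inj₁ x≤y = contradiction x≤y x≰y
    ...   | inj₂ y≤x = inj₂ (y≤x , λ y≈x → x≰y (≤-reflexive (sym y≈x)))

    ≰⇒> : ∀ {x y} → ¬ (x ≤ y) → y < x
    ≰⇒> {x} {y} x≰y = [ (λ x≤y → contradiction x≤y x≰y) , (λ p → p) ]′ (≤-<-total x y)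

    ≮⇒≥ : ∀ {x y} → ¬ (x < y) → y ≤ x
    ≮⇒≥ {x} {y} x≮y = [ (λ p → p) , (λ x<y → contradiction x<y x≮y) ]′ (≤-<-total y x)

    +-nonneg : ∀ {x y} → 0# ≤ x → 0# ≤ y → 0# ≤ x + y
    +-nonneg {x} 0≤x 0≤y = ≤-trans 0≤x (≤-respˡ (+-identityʳ x) (+-monoʳ-≤ x 0≤y))

    +-pos-nonneg : ∀ {x y} → 0# < x → 0# ≤ y → 0# < x + y
    +-pos-nonneg {x} 0<x 0≤y = <-≤-trans 0<x (≤-respˡ (+-identityʳ x) (+-monoʳ-≤ x 0≤y))

    +-pos : ∀ {x y} → 0# < x → 0# < y → 0# < x + y
    +-pos 0<x (0≤y , _) = +-pos-nonneg 0<x 0≤y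

    *-zero-cancel : ∀ {x y} → ¬ (x ≈ 0#) → x * y ≈ 0# → y ≈ 0#
    *-zero-cancel {x} {y} x≉0 xy≈0 with i , xi≈1 ← inverse x x≉0 = begin
      y            ≈⟨ *-identityˡ y ⟨
      1# * y       ≈⟨ *-congʳ xi≈1 ⟨
      x * i * y    ≈⟨ solve 3 (λ x i y → x :* i :* y := i :* (x :* y)) refl x i y ⟩
      i * (x * y)  ≈⟨ *-congˡ xy≈0 ⟩
      i * 0#       ≈⟨ zeroʳ i ⟩
      0#           ∎
      where open import Relation.Binary.Reasoning.Setoid setoid

    *-pos : ∀ {x y} → 0# < x → 0# < y → 0# < x * y
    *-pos (0≤x , 0≉x) (0≤y , 0≉y) =
      *-nonneg 0≤x 0≤y , λ 0≈xy → 0≉y (sym (*-zero-cancel (0≉x ∘ sym) (sym 0≈xy)))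

    neg-nonneg : ∀ {x} → x ≤ 0# → 0# ≤ - x
    neg-nonneg x≤0 = ≤-respʳ (+-identityˡ _) (≤⇒0≤ x≤0)

    neg-pos : ∀ {x} → x < 0# → 0# < - x
    neg-pos x<0 = <-respʳ (+-identityˡ _) (<⇒0< x<0)

    0<1 : 0# < 1#
    0<1 with total 0# 1#
    ... | inj₁ 0≤1 = 0≤1 , 0≉1
    ... | inj₂ 1≤0 = ≤-respʳ (solve 0 (:- :1 :* :- :1 := :1) refl)
                       (*-nonneg (neg-nonneg 1≤0) (neg-nonneg 1≤0)) , 0≉1

    pos⇒≉0 : ∀ {x} → 0# < x → ¬ (x ≈ 0#)
    pos⇒≉0 (_ , 0≉x) = 0≉x ∘ sym

    pos-inverse : ∀ {x} → 0# < x → ∃[ y ] 0# < y × x * y ≈ 1#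
    pos-inverse {x} 0<x = y , ≰⇒> y≰0 , xy≈1
      where
      y : Carrier
      y = proj₁ (inverse x (pos⇒≉0 0<x))
      xy≈1 : x * y ≈ 1#
      xy≈1 = proj₂ (inverse x (pos⇒≉0 0<x))
      eq : x * - y ≈ 0# - 1#
      eq = trans (solve 2 (λ x y → x :* :- y := :0 :- x :* y) refl x y) (+-congˡ (-‿cong xy≈1))
      y≰0 : ¬ (y ≤ 0#)
      y≰0 y≤0 = <⇒≱ 0<1 (0≤⇒≤ (≤-respʳ eq (*-nonneg (proj₁ 0<x) (neg-nonneg y≤0))))

    half : ∃[ h ] 0# < h × h + h ≈ 1#
    half = let h , 0<h , eq = pos-inverse (+-pos 0<1 0<1) in
      h , 0<h , trans (solve 1 (λ h → h :+ h := (:1 :+ :1) :* h) refl h) eq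

    halve : ∀ {x} → 0# < x → ∃[ y ] 0# < y × y + y ≈ x
    halve {x} 0<x = let h , 0<h , eq = half in
      h * x , *-pos 0<h 0<x , trans (sym (distribʳ x h h)) (trans (*-congʳ eq) (*-identityˡ x))

    half-< : ∀ {x} → 0# < x → ∃[ y ] 0# < y × y < x
    half-< {x} 0<x = let y , 0<y , eq = halve 0<x in
      y , 0<y , 0<⇒< (<-respʳ (trans (solve 1 (λ y → y := y :+ y :- y) refl y) (+-congʳ eq)) 0<y)

    x-ε<x : ∀ {x ε} → 0# < ε → x - ε < x
    x-ε<x {x} {ε} 0<ε = 0<⇒< (<-respʳ (solve 2 (λ x ε → ε := x :- (x :- ε)) refl x ε) 0<ε)

    x<x+ε : ∀ {x ε} → 0# < ε → x < x + ε
    x<x+ε {x} {ε} 0<ε = 0<⇒< (<-respʳ (solve 2 (λ x ε → ε := x :+ ε :- x) refl x ε) 0<ε)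

    dense : ∀ {x y} → x < y → ∃[ z ] x < z × z < y
    dense {x} {y} x<y = let δ , 0<δ , δ< = half-< (<⇒0< x<y) in
      x + δ , x<x+ε 0<δ ,
      0<⇒< (<-respʳ (solve 3 (λ x y δ → y :- x :- δ := y :- (x :+ δ)) refl x y δ) (<⇒0< δ<))

    min : ∀ {x y} → 0# < x → 0# < y → ∃[ z ] 0# < z × z ≤ x × z ≤ y
    min {x} {y} 0<x 0<y with total x y
    ... | inj₁ x≤y = x , 0<x , ≤-refl , x≤y
    ... | inj₂ y≤x = y , 0<y , y≤x , ≤-refl

    bounded : ∀ c → ∃[ M ] 0# < M × - M < c × c < M
    bounded c with ≤-<-total 0# c
    ... | inj₁ 0≤c = c + 1# , <-respʳ (+-comm 1# c) (+-pos-nonneg 0<1 0≤c)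
        , 0<⇒< (<-respʳ (solve 1 (λ c → :1 :+ (c :+ c) := c :- :- (c :+ :1)) refl c)
                         (+-pos-nonneg 0<1 (+-nonneg 0≤c 0≤c)))
        , 0<⇒< (<-respʳ (solve 1 (λ c → :1 := c :+ :1 :- c) refl c) 0<1)
    ... | inj₂ c<0 = 1# - c , +-pos 0<1 (neg-pos c<0)
        , 0<⇒< (<-respʳ (solve 1 (λ c → :1 := c :- :- (:1 :- c)) refl c) 0<1)
        , 0<⇒< (<-respʳ (solve 1 (λ c → :1 :+ (:- c :+ :- c) := :1 :- c :- c) refl c)
                         (+-pos 0<1 (+-pos (neg-pos c<0) (neg-pos c<0))))

    -- Take ε = η / M with -M < c < M. Instead of absolute values, add products of positive numbers:
    -- (z + ε)(c + M) + (ε - z)(M - c) = 2(Mε + zc) gives zc > -η, and exchanging c + M with M - c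
    -- gives zc < η.
    product-small : ∀ {η} c → 0# < η →
                    ∃[ ε ] 0# < ε × (∀ z → - ε < z → z < ε → - η < z * c × z * c < η)
    product-small {η} c 0<η =
      let M , 0<M , -M<c , c<M = bounded c
          i , 0<i , Mi≈1       = pos-inverse 0<M
      in η * i , *-pos 0<η 0<i , λ z -ε<z z<ε →
        let ε   = η * i
            Mε  = trans (solve 3 (λ M η i → M :* (η :* i) := η :* (M :* i)) refl M η i)
                        (trans (*-congˡ Mi≈1) (*-identityʳ η))
            ε+z = <⇒0< -ε<z
            ε-z = <⇒0< z<ε
            c+M = <⇒0< -M<c
            M-c = <⇒0< c<M
            lower≈ = trans (solve 4 (λ ε z M c → (z :- :- ε) :* (c :- :- M) :+ (ε :- z) :* (M :- c)
                                               := (M :* ε :+ z :* c) :+ (M :* ε :+ z :* c)) refl ε z M c)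
                           (+-cong (+-congʳ Mε) (+-congʳ Mε))
            upper≈ = trans (solve 4 (λ ε z M c → (z :- :- ε) :* (M :- c) :+ (ε :- z) :* (c :- :- M)
                                               := (M :* ε :- z :* c) :+ (M :* ε :- z :* c)) refl ε z M c)
                           (+-cong (+-congʳ Mε) (+-congʳ Mε))
        in 0<⇒< (<-respʳ (solve 2 (λ η w → η :+ w := w :- :- η) refl η (z * c))
                          (double-pos (<-respʳ lower≈ (+-pos (*-pos ε+z c+M) (*-pos ε-z M-c)))))
         , 0<⇒< (double-pos (<-respʳ upper≈ (+-pos (*-pos ε+z M-c) (*-pos ε-z c+M))))
      where
      double-pos : ∀ {x} → 0# < x + x → 0# < x
      double-pos {x} 0<2x with ≤-<-total x 0#
      ... | inj₂ 0<x = 0<x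
      ... | inj₁ x≤0 = contradiction
        (0≤⇒≤ (≤-respʳ (solve 1 (λ x → :- x :+ :- x := :0 :- (x :+ x)) refl x)
                        (+-nonneg (neg-nonneg x≤0) (neg-nonneg x≤0))))
        (<⇒≱ 0<2x)

    between : ∀ {x y z} → x ≤ z → z ≤ y →
              ∃[ a ] ∃[ b ] 0# ≤ a × 0# ≤ b × a + b ≈ 1# × z ≈ a * x + b * y
    between {x} {y} {z} x≤z z≤y with dec (x ≈ y)
    ... | yes x≈y = 1# , 0# , proj₁ 0<1 , ≤-refl , +-identityʳ 1#
        , trans (antisym (≤-respʳ (sym x≈y) z≤y) x≤z) (solve 2 (λ x y → x := :1 :* x :+ :0 :* y) refl x y)
    ... | no  x≉y = let i , 0<i , eq = pos-inverse (<⇒0< (≤-trans x≤z z≤y , x≉y)) in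
        (y - z) * i , (z - x) * i
        , *-nonneg (≤⇒0≤ z≤y) (proj₁ 0<i) , *-nonneg (≤⇒0≤ x≤z) (proj₁ 0<i)
        , trans (solve 4 (λ x y z i → (y :- z) :* i :+ (z :- x) :* i := (y :- x) :* i) refl x y z i) eq
        , (begin
            z                                       ≈⟨ *-identityˡ z ⟨
            1# * z                                  ≈⟨ *-congʳ eq ⟨
            (y - x) * i * z                         ≈⟨ solve 4 (λ x y z i → (y :- x) :* i :* z
                                                          := (y :- z) :* i :* x :+ (z :- x) :* i :* y) refl x y z i ⟩
            (y - z) * i * x + (z - x) * i * y       ∎)
      where open import Relation.Binary.Reasoning.Setoid setoid

-- `F` plays the role of a filter; the instances are small positive numbers, `Small`, and
-- neighbourhoods of a point, `Near`.
fin-all : ∀ {A : Set} {F : Pred A 0ℓ → Set} →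
          (∀ {P Q} → P ⊆ Q → F P → F Q) → F U → (∀ {P Q} → F P → F Q → F (P ∩ Q)) →
          ∀ {n} {P : Fin n → Pred A 0ℓ} → (∀ i → F (P i)) → F (λ a → ∀ i → P i a)
fin-all mono F-U F-∩ {zero}  Fs = mono (λ _ ()) F-U
fin-all mono F-U F-∩ {suc n} Fs =
  mono (λ { (p , ps) zero → p ; (p , ps) (suc i) → ps i })
    (F-∩ (Fs zero) (fin-all mono F-U F-∩ (Fs ∘ suc)))

-- Continuity, connectedness and partitions into convex open cells

module Topology (em : ExcludedMiddle (lsuc 0ℓ)) (ℝ : CompleteOrderedField) where
  open CompleteOrderedField ℝ hiding (zero)
  open Reals em ℝ
  open SemiringSum semiring using (sum)

  -- The filter of right neighbourhoods of 0. Perturbations are stated in it so that finitely many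
  -- conditions on a step length are met by a single step.
  Small : Pred Carrier 0ℓ → Set
  Small P = ∃[ ε ] 0# < ε × (∀ δ → 0# < δ → δ < ε → P δ)

  opaque
    small-mono : ∀ {P Q} → P ⊆ Q → Small P → Small Q
    small-mono P⊆Q (ε , 0<ε , p) = ε , 0<ε , λ δ 0<δ δ<ε → P⊆Q (p δ 0<δ δ<ε)

    small-∩ : ∀ {P Q} → Small P → Small Q → Small (P ∩ Q)
    small-∩ (ε , 0<ε , p) (ε′ , 0<ε′ , q) = let η , 0<η , η≤ε , η≤ε′ = min 0<ε 0<ε′ in
      η , 0<η , λ δ 0<δ δ<η → p δ 0<δ (<-≤-trans δ<η η≤ε) , q δ 0<δ (<-≤-trans δ<η η≤ε′)

    small-all : ∀ {n} {P : Fin n → Pred Carrier 0ℓ} → (∀ i → Small (P i)) → Small (λ δ → ∀ i → P i δ)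
    small-all = fin-all {F = Small} small-mono (1# , 0<1 , _) small-∩

    small-witness : ∀ {P} → Small P → ∃[ δ ] 0# < δ × P δ
    small-witness (ε , 0<ε , p) = let δ , 0<δ , δ<ε = half-< 0<ε in δ , 0<δ , p δ 0<δ δ<ε

    small-product : ∀ {η} c → 0# < η → Small (λ δ → - η < δ * c × δ * c < η)
    small-product c 0<η = let ε , 0<ε , bound = product-small c 0<η in
      ε , 0<ε , λ δ 0<δ δ<ε → bound δ (<-trans (neg-<0 0<ε) 0<δ) δ<ε
      where
      neg-<0 : ∀ {ε} → 0# < ε → - ε < 0#
      neg-<0 {ε} 0<ε = 0<⇒< (<-respʳ (solve 1 (λ ε → ε := :0 :- :- ε) refl ε) 0<ε)

    +-above : ∀ {x y η} → - η < y → x - η < x + y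
    +-above {x} {y} {η} p = 0<⇒< (<-respʳ (solve 3 (λ x y η → y :- :- η := (x :+ y) :- (x :- η)) refl x y η) (<⇒0< p))

    +-below : ∀ {x y η} → y < η → x + y < x + η
    +-below {x} {y} {η} p = 0<⇒< (<-respʳ (solve 3 (λ x y η → η :- y := (x :+ η) :- (x :+ y)) refl x y η) (<⇒0< p))

    small-pos : ∀ {a} c → 0# < a → Small (λ δ → 0# < a + δ * c)
    small-pos {a} c 0<a = small-mono (λ (p , _) → <-respˡ (-‿inverseʳ a) (+-above p)) (small-product c 0<a)

  record Linear {d} (f : Vector Carrier d → Carrier) : Set where
    field
      cong        : ∀ {x y} → (∀ t → x t ≈ y t) → f x ≈ f y
      additive    : ∀ x y → f (λ t → x t + y t) ≈ f x + f y
      homogeneous : ∀ c x → f (λ t → c * x t) ≈ c * f x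

    zero-value : f (λ _ → 0#) ≈ 0#
    zero-value = trans (cong (λ _ → sym (zeroˡ 0#))) (trans (homogeneous 0# (λ _ → 0#)) (zeroˡ _))

    combination : ∀ {p} (c : Vector Carrier p) (v : Vector (Vector Carrier d) p) →
                  f (λ t → sum (λ i → c i * v i t)) ≈ sum (λ i → c i * f (v i))
    combination {zero}  c v = zero-value
    combination {suc p} c v =
      trans (additive _ _) (+-cong (homogeneous _ _) (combination (tail c) (tail v)))

    affine : ∀ x δ y → f (λ t → x t + δ * y t) ≈ f x + δ * f y
    affine x δ y = trans (additive _ _) (+-congˡ (homogeneous δ y))

    difference : ∀ x y → f y ≈ f x + f (λ t → y t - x t)
    difference x y = trans (cong (λ t → solve 2 (λ x y → y := x :+ (y :- x)) refl (x t) (y t))) (additive _ _)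

  open Linear

  opaque
    linear-scale : ∀ {d} {f : Vector Carrier d → Carrier} c → Linear f → Linear (λ x → c * f x)
    linear-scale {f = f} c lf = record
      { cong        = λ x≈y → *-congˡ (cong lf x≈y)
      ; additive    = λ x y → trans (*-congˡ (additive lf x y)) (distribˡ c _ _)
      ; homogeneous = λ e x → trans (*-congˡ (homogeneous lf e x))
                                (solve 3 (λ c e y → c :* (e :* y) := e :* (c :* y)) refl c e (f x))
      }

    linear-difference : ∀ {d} {f g : Vector Carrier d → Carrier} → Linear f → Linear g → Linear (λ x → f x - g x)
    linear-difference {f = f} {g} lf lg = record
      { cong        = λ x≈y → +-cong (cong lf x≈y) (-‿cong (cong lg x≈y))
      ; additive    = λ x y → trans (+-cong (additive lf x y) (-‿cong (additive lg x y)))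
          (solve 4 (λ a b c d → (a :+ b) :- (c :+ d) := (a :- c) :+ (b :- d)) refl (f x) (f y) (g x) (g y))
      ; homogeneous = λ c x → trans (+-cong (homogeneous lf c x) (-‿cong (homogeneous lg c x)))
          (solve 3 (λ c a b → c :* a :- c :* b := c :* (a :- b)) refl c (f x) (g x))
      }

    -- Induction on the coordinates: half of η is spent on the first coordinate and half on the
    -- others. A lower bound is what openness of the set where f is positive asks for.
    linear-continuous : ∀ {d} {f : Vector Carrier d → Carrier} → Linear f → ∀ {η} → 0# < η →
                        ∃[ ε ] 0# < ε × (∀ z → (∀ t → - ε < z t × z t < ε) → - η < f z)
    linear-continuous {zero}  {f} lf {η} 0<η = 1# , 0<1 , λ z _ →
      <-respʳ (trans (sym (zero-value lf)) (cong lf λ ())) (0<⇒< (<-respʳ (solve 1 (λ η → η := :0 :- :- η) refl η) 0<η))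
    linear-continuous {suc d} {f} lf {η} 0<η =
      let θ , 0<θ , θ+θ≈η    = halve 0<η
          ε₁ , 0<ε₁ , bound₁ = product-small (f e₀) 0<θ
          ε₂ , 0<ε₂ , bound₂ = linear-continuous linear-rest 0<θ
          ε , 0<ε , ε≤₁ , ε≤₂ = min 0<ε₁ 0<ε₂
          shrink             = λ {ε′ z} (ε≤ε′ : ε ≤ ε′) ((p , q) : - ε < z × z < ε) →
            ≤-<-trans (neg-≤ ε≤ε′) p , <-≤-trans q ε≤ε′
      in ε , 0<ε , λ z small →
        let p , q = shrink ε≤₁ (small zero)
            a     = proj₁ (bound₁ (z zero) p q)
            b     = bound₂ (tail z) (λ t → shrink ε≤₂ (small (suc t)))
        in 0<⇒< (<-respʳ (trans
             (solve 3 (λ u v θ → (u :- :- θ) :+ (v :- :- θ) := (u :+ v) :- :- (θ :+ θ)) refl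
                 (z zero * f e₀) (f (0# ∷ᵛ tail z)) θ)
             (+-cong (sym (split z)) (-‿cong (-‿cong θ+θ≈η))))
             (+-pos (<⇒0< a) (<⇒0< b)))
      where
      e₀ : Vector Carrier (suc d)
      e₀ = 1# ∷ᵛ λ _ → 0#
      neg-≤ : ∀ {x y} → x ≤ y → - y ≤ - x
      neg-≤ {x} {y} p = 0≤⇒≤ (≤-respʳ (solve 2 (λ x y → y :- x := :- x :- :- y) refl x y) (≤⇒0≤ p))
      linear-rest : Linear (λ z → f (0# ∷ᵛ z))
      linear-rest = record
        { cong        = λ x≈y → cong lf λ { zero → refl ; (suc t) → x≈y t }
        ; additive    = λ x y → trans (cong lf λ { zero → sym (+-identityˡ 0#) ; (suc t) → refl }) (additive lf _ _)
        ; homogeneous = λ c x → trans (cong lf λ { zero → sym (zeroʳ c) ; (suc t) → refl }) (homogeneous lf _ _)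
        }
      split : ∀ z → f z ≈ z zero * f e₀ + f (0# ∷ᵛ tail z)
      split z = trans (cong lf λ { zero → solve 1 (λ a → a := a :* :1 :+ :0) refl (z zero)
                                 ; (suc t) → solve 2 (λ a b → b := a :* :0 :+ b) refl (z zero) (z (suc t)) })
                  (trans (additive lf _ _) (+-congʳ (homogeneous lf (z zero) e₀)))

  module _ {d : ℕ} where
    open Euclidean ℝ d

    Near : Point → Pred Point 0ℓ → Set
    Near x P = ∃[ ε ] 0# < ε × Ball x ε ⊆ P

    opaque
      ball-mono : ∀ {x ε ε′} → ε ≤ ε′ → Ball x ε ⊆ Ball x ε′
      ball-mono {x} {ε} {ε′} ε≤ε′ y∈ t = let p , q = y∈ t in
          ≤-<-trans (0≤⇒≤ (≤-respʳ (solve 3 (λ x ε ε′ → ε′ :- ε := (x :- ε) :- (x :- ε′)) refl (x t) ε ε′)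
              (≤⇒0≤ ε≤ε′))) p
        , <-≤-trans q (+-monoʳ-≤ (x t) ε≤ε′)

      near-mono : ∀ {x P Q} → P ⊆ Q → Near x P → Near x Q
      near-mono P⊆Q (ε , 0<ε , p) = ε , 0<ε , P⊆Q ∘ p

      near-∩ : ∀ {x P Q} → Near x P → Near x Q → Near x (P ∩ Q)
      near-∩ {x} (ε , 0<ε , p) (ε′ , 0<ε′ , q) = let η , 0<η , η≤ε , η≤ε′ = min 0<ε 0<ε′ in
        η , 0<η , λ y∈ → p (ball-mono {x} η≤ε y∈) , q (ball-mono {x} η≤ε′ y∈)

      near-all : ∀ {x n} {P : Fin n → Pred Point 0ℓ} → (∀ i → Near x (P i)) → Near x (λ y → ∀ i → P i y)
      near-all {x} = fin-all {F = Near x} near-mono (1# , 0<1 , _) (near-∩ {x})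

      ball-center : ∀ {x y ε} → 0# < ε → x ≋ y → Ball x ε y
      ball-center {x} {y} {ε} 0<ε x≋y t =
          <-respʳ (x≋y t) (x-ε<x 0<ε)
        , <-respˡ (x≋y t) (x<x+ε 0<ε)

      -- Points are functions compared up to `≋`, and a predicate need not respect this equality. An
      -- open one does, because a ball around x contains every point equal to x. This is why
      -- openness is assumed in statements about convexity such as `slice-convex`.
      open-resp : ∀ {P} → Open P → ∀ {x y} → x ≋ y → P x → P y
      open-resp openP {x} x≋y x∈ = let ε , 0<ε , ball = openP x∈ in ball (ball-center {x} 0<ε x≋y)

      near-line : ∀ {P x} → Near x P → ∀ (y : Point) → Small (λ δ → P (λ t → x t + δ * y t))
      near-line (ε , 0<ε , ball) y =
        small-mono (λ p → ball λ t → +-above (proj₁ (p t)) , +-below (proj₂ (p t)))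
          (small-all λ t → small-product (y t) 0<ε)

      open-line : ∀ {P} → Open P → ∀ {x} → P x → ∀ (y : Point) → Small (λ δ → P (λ t → x t + δ * y t))
      open-line openP {x} x∈ = near-line {x = x} (openP x∈)

      near-positive : ∀ {f} → Linear f → ∀ {x} → 0# < f x → Near x (λ y → 0# < f y)
      near-positive {f} lf {x} 0<fx = let ε , 0<ε , bound = linear-continuous lf 0<fx in
        ε , 0<ε , λ {y} y∈ → <-respˡ (-‿inverseʳ (f x)) (<-respʳ (sym (difference lf x y))
          (+-above (bound (λ t → y t - x t) λ t → let p , q = y∈ t in
              0<⇒< (<-respʳ (solve 3 (λ x y ε → y :- (x :- ε) := (y :- x) :- :- ε) refl (x t) (y t) ε) (<⇒0< p))
            , 0<⇒< (<-respʳ (solve 3 (λ x y ε → x :+ ε :- y := ε :- (y :- x)) refl (x t) (y t) ε) (<⇒0< q)))))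

      near-< : ∀ {f g} → Linear f → Linear g → ∀ {x} → f x < g x → Near x (λ y → f y < g y)
      near-< lf lg {x} fx<gx =
        near-mono 0<⇒< (near-positive (linear-difference lg lf) {x} (<⇒0< fx<gx))

    Convex : Pred Point 0ℓ → Set
    Convex C = ∀ {x y} → C x → C y → ∀ {a b} → 0# ≤ a → 0# ≤ b → a + b ≈ 1# →
               C (λ t → a * x t + b * y t)

    opaque
      -- Let σ be the supremum of the parameters at which the segment from x to y lies in U. If its
      -- point were in U, either σ = 1 and y lies in both sets, or the segment stays in U a little
      -- beyond σ. If it were in V, the points just before σ would lie in V, and a smaller number
      -- would be an upper bound.
      convex-connected : ∀ {C} → Convex C → Connected C
      convex-connected {C} convex U V openU openV cover disjoint ((x , x∈C , x∈U) , (y , y∈C , y∈V)) =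
        [ σ∉U , σ∉V ]′ (cover (γ∈C 0≤σ σ≤1))
        where
        γ : Carrier → Point
        γ s t = (1# - s) * x t + s * y t
        γ∈C : ∀ {s} → 0# ≤ s → s ≤ 1# → C (γ s)
        γ∈C {s} 0≤s s≤1 = convex x∈C y∈C (≤⇒0≤ s≤1) 0≤s (solve 1 (λ s → :1 :- s :+ s := :1) refl s)
        P : Pred Carrier 0ℓ
        P s = 0# ≤ s × s ≤ 1# × U (γ s)
        P0 : P 0#
        P0 = ≤-refl , proj₁ 0<1
           , open-resp openU (λ t → solve 2 (λ x y → x := (:1 :- :0) :* x :+ :0 :* y) refl (x t) (y t)) x∈U
        s-up : ∃[ s ] UpperBound P s × (∀ u → UpperBound P u → s ≤ u)
        s-up = supremum P (0# , P0) (1# , λ (_ , s≤1 , _) → s≤1)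
        σ : Carrier
        σ = proj₁ s-up
        upper : UpperBound P σ
        upper = proj₁ (proj₂ s-up)
        least : ∀ u → UpperBound P u → σ ≤ u
        least = proj₂ (proj₂ s-up)
        0≤σ : 0# ≤ σ
        0≤σ = upper P0
        σ≤1 : σ ≤ 1#
        σ≤1 = least 1# λ (_ , s≤1 , _) → s≤1
        σ∉U : ¬ U (γ σ)
        σ∉U σ∈U =
          let ε , 0<ε , inU    = open-line openU σ∈U (λ t → y t - x t)
              m , 0<m , m≤ , m≤ε = min (<⇒0< (σ≤1 , σ≉1)) 0<ε
              δ , 0<δ , δ<m    = half-< 0<m
              σ+δ≤1            = 0≤⇒≤ (≤-respʳ (solve 2 (λ σ δ → (:1 :- σ) :- δ := :1 :- (σ :+ δ)) refl σ δ)
                                               (≤⇒0≤ (≤-trans (proj₁ δ<m) m≤)))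
          in <⇒≱ (x<x+ε 0<δ)
               (upper {σ + δ} (+-nonneg 0≤σ (proj₁ 0<δ) , σ+δ≤1
                 , open-resp openU {x = λ t → γ σ t + δ * (y t - x t)}
                     (λ t → solve 4 (λ σ δ x y → (:1 :- σ) :* x :+ σ :* y :+ δ :* (y :- x)
                                       := (:1 :- (σ :+ δ)) :* x :+ (σ :+ δ) :* y) refl σ δ (x t) (y t))
                     (inU δ 0<δ (<-≤-trans δ<m m≤ε))))
          where
          σ≉1 : ¬ (σ ≈ 1#)
          σ≉1 σ≈1 = disjoint (y , y∈C , open-resp openU
            (λ t → trans (+-cong (*-congʳ (+-congˡ (-‿cong σ≈1))) (*-congʳ σ≈1))
                     (solve 2 (λ x y → (:1 :- :1) :* x :+ :1 :* y := y) refl (x t) (y t))) σ∈U , y∈V)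
        σ∉V : ¬ V (γ σ)
        σ∉V σ∈V =
          let ε , 0<ε , inV = open-line openV σ∈V (λ t → x t - y t)
              bound : UpperBound P (σ - ε)
              bound {s} = λ (0≤s , s≤1 , s∈U) → by-contradiction λ s≰ →
                let σ-s<ε = 0<⇒< (<-respʳ (solve 3 (λ s σ ε → s :- (σ :- ε) := ε :- (σ :- s)) refl s σ ε)
                        (<⇒0< (≰⇒> s≰)))
                    s≤σ   = upper {s} (0≤s , s≤1 , s∈U)
                    s≉σ : ¬ (s ≈ σ)
                    s≉σ = λ s≈σ → disjoint (γ s , γ∈C 0≤s s≤1 , s∈U
                            , open-resp openV (λ t → sym (+-cong (*-congʳ (+-congˡ (-‿cong s≈σ))) (*-congʳ s≈σ))) σ∈V)
                in disjoint (γ s , γ∈C 0≤s s≤1 , s∈U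
                     , open-resp openV {x = λ t → γ σ t + (σ - s) * (x t - y t)}
                         (λ t → solve 4 (λ σ s x y → (:1 :- σ) :* x :+ σ :* y :+ (σ :- s) :* (x :- y)
                                           := (:1 :- s) :* x :+ s :* y) refl σ s (x t) (y t))
                         (inV (σ - s) (<⇒0< (s≤σ , s≉σ)) σ-s<ε))
          in <⇒≱ (x-ε<x 0<ε) (least (σ - ε) bound)

    -- This serves twice: by `components-cardinality` the cells are the connected components of X,
    -- and by `integral-partition` they write its indicator as a sum of admissible ones. Because no
    -- cell is empty, r is the exact count.
    record OpenPartition (X : Pred Point 0ℓ) (r : ℕ) : Set₁ where
      field
        cell     : Fin r → Pred Point 0ℓ
        isOpen   : ∀ i → Open (cell i)
        isConvex : ∀ i → Convex (cell i)
        nonempty : ∀ i → ∃ (cell i)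
        disjoint : ∀ {i j x} → cell i x → cell j x → i ≡ j
        covers   : ∀ {x} → X x → ∃[ i ] cell i x
        sound    : ∀ {i x} → cell i x → X x

    opaque
      open-partition-resp : ∀ {X Y r} → X ≐ Y → OpenPartition X r → OpenPartition Y r
      open-partition-resp (X⊆Y , Y⊆X) π = record
        { cell = cell ; isOpen = isOpen ; isConvex = isConvex ; nonempty = nonempty ; disjoint = disjoint
        ; covers = covers ∘ Y⊆X ; sound = X⊆Y ∘ sound }
        where open OpenPartition π

      -- Cells are connected because they are convex. A connected subset of X cannot meet two of
      -- them, since one cell and the union of all the others are disjoint open sets covering X.
      components-cardinality : ∀ {X r} → OpenPartition X r → HasCardinality (components X) r
      components-cardinality {X} {r} π = record
        { to        = index
        ; from      = point
        ; to-cong   = λ {x} {y} → index-cong {x} {y}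
        ; from-cong = λ { {i} ≡.refl → Setoid.refl (components X) {point i} }
        ; inverse   = (λ {i} {x} x~ → ≡.trans (index-cong {x} {point i} x~) (index-point i))
                    , (λ { {x} ≡.refl → cell (index x) , convex-connected (isConvex _) , sound
                                      , proj₂ (nonempty (index x)) , index-cell x })
        }
        where
        open OpenPartition π
        index : Σ Point X → Fin r
        index (_ , x∈X) = proj₁ (covers x∈X)
        index-cell : ∀ x → cell (index x) (proj₁ x)
        index-cell (_ , x∈X) = proj₂ (covers x∈X)
        point : Fin r → Σ Point X
        point i = proj₁ (nonempty i) , sound (proj₂ (nonempty i))
        index-point : ∀ i → index (point i) ≡ i
        index-point i = disjoint (index-cell (point i)) (proj₂ (nonempty i))
        index-cong : ∀ {x y} → SameComponent X (proj₁ x) (proj₁ y) → index x ≡ index y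
        index-cong {x} {y} (C , connected , C⊆X , x∈C , y∈C) with index x Fin.≟ index y
        ... | yes eq = eq
        ... | no  x≢y  = ⊥-elim (connected (cell i) Others (isOpen i) open-others cover disjoint′
                         ((proj₁ x , x∈C , index-cell x) , (proj₁ y , y∈C , index y , x≢y ∘ ≡.sym , index-cell y)))
          where
          i : Fin r
          i = index x
          Others : Pred Point 0ℓ
          Others z = ∃[ j ] j ≢ i × cell j z
          open-others : Open Others
          open-others (j , j≢i , z∈) = let ε , 0<ε , ball = isOpen j z∈ in ε , 0<ε , λ w∈ → j , j≢i , ball w∈
          cover : ∀ {z} → C z → cell i z ⊎ Others z
          cover z∈C with covers (C⊆X z∈C)
          ... | j , z∈ with j Fin.≟ i
          ...   | yes ≡.refl = inj₁ z∈
          ...   | no  j≢i    = inj₂ (j , j≢i , z∈)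
          disjoint′ : ¬ (∃[ z ] C z × cell i z × Others z)
          disjoint′ (z , _ , z∈i , j , j≢i , z∈j) = j≢i (disjoint z∈j z∈i)

      -- The family may contain empty sets and repetitions. The first set is kept only if it has a
      -- point x outside the later ones; it is then disjoint from each of them, since a set that it
      -- meets contains it and hence x.
      open-partition : ∀ {N} (V : Fin N → Pred Point 0ℓ) → (∀ i → Open (V i)) → (∀ i → Convex (V i)) →
                       (∀ {i j x} → V i x → V j x → V i ⊆ V j) →
                       ∃[ r ] OpenPartition (λ x → ∃[ i ] V i x) r
      open-partition {zero}  V _ _ _ = 0 , record
        { cell = λ () ; isOpen = λ () ; isConvex = λ () ; nonempty = λ () ; disjoint = λ { {()} }
        ; covers = λ () ; sound = λ { {()} } }
      open-partition {suc N} V openV convexV coincide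
        with open-partition (V ∘ suc) (openV ∘ suc) (convexV ∘ suc) coincide
           | dec (∃[ x ] V zero x × ¬ (∃[ i ] V (suc i) x))
      ... | r , π | no covered = r , open-partition-resp
          ( (λ (i , x∈) → suc i , x∈)
          , (λ { {x} (zero  , x∈) → by-contradiction λ x∉ → covered (x , x∈ , x∉)
               ; {x} (suc i , x∈) → i , x∈ }) ) π
      ... | r , π | yes (x , x∈ , x∉) = suc r , record
        { cell     = λ { zero → V zero ; (suc i) → cell i }
        ; isOpen   = λ { zero → openV zero ; (suc i) → isOpen i }
        ; isConvex = λ { zero → convexV zero ; (suc i) → isConvex i }
        ; nonempty = λ { zero → x , x∈ ; (suc i) → nonempty i }
        ; disjoint = λ { {zero}  {zero}  _  _  → ≡.refl
                       ; {zero}  {suc j} p  q  → contradiction (sound q) (separated p)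
                       ; {suc i} {zero}  p  q  → contradiction (sound p) (separated q)
                       ; {suc i} {suc j} p  q  → ≡.cong suc (disjoint p q) }
        ; covers   = λ { (zero , p) → zero , p ; (suc i , p) → let j , q = covers (i , p) in suc j , q }
        ; sound    = λ { {zero} p → zero , p ; {suc i} p → let j , q = sound p in suc j , q }
        }
        where
        open OpenPartition π
        separated : ∀ {y} → V zero y → ¬ (∃[ i ] V (suc i) y)
        separated y∈ (i , y∈i) = x∉ (i , coincide y∈ y∈i x∈)

      open-∩ : ∀ {P Q} → Open P → Open Q → Open (P ∩ Q)
      open-∩ openP openQ {x} (p , q) = near-∩ {x} (openP p) (openQ q)

      -- Cells of the two partitions are intersected pairwise; `open-partition` discards the empty
      -- intersections.
      open-partition-∩ : ∀ {X Y r s} → OpenPartition X r → OpenPartition Y s →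
                         ∃[ t ] OpenPartition (X ∩ Y) t
      open-partition-∩ {X} {Y} {r} {s} π ρ =
        let t , τ = open-partition V
                      (λ k → open-∩ (P.isOpen (proj₁ (split k))) (R.isOpen (proj₂ (split k))))
                      (λ k (p , q) (p′ , q′) 0≤a 0≤b a+b≈1 →
                        P.isConvex (proj₁ (split k)) p p′ 0≤a 0≤b a+b≈1 ,
                        R.isConvex (proj₂ (split k)) q q′ 0≤a 0≤b a+b≈1)
                      (λ (p , q) (p′ , q′) (u , v) →
                        ≡.subst (λ i → P.cell i _) (P.disjoint p p′) u , ≡.subst (λ j → R.cell j _) (R.disjoint q q′) v)
        in t , open-partition-resp
          ( (λ (_ , p , q) → P.sound p , R.sound q)
          , (λ (p , q) → let i , p∈ = P.covers p ; j , q∈ = R.covers q in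
              combine i j , ≡.subst (λ (i , j) → (P.cell i ∩ R.cell j) _)
                  (≡.sym (Fin.remQuot-combine i j)) (p∈ , q∈)) ) τ
        where
        module P = OpenPartition π
        module R = OpenPartition ρ
        split : Fin (r ℕ.* s) → Fin r × Fin s
        split = remQuot s
        V : Fin (r ℕ.* s) → Pred Point 0ℓ
        V k = P.cell (proj₁ (split k)) ∩ R.cell (proj₂ (split k))

      open-partition-⋂ : ∀ {m} {X : Fin m → Pred Point 0ℓ} → (∀ i → ∃ (OpenPartition (X i))) →
                         ∀ (S : Subset m) → ∃ (OpenPartition (λ x → ∀ i → i ∈ₛ S → X i x))
      -- The empty intersection is the whole space in one cell, which gives the value 1 for the
      -- empty arrangement.
      open-partition-⋂ πs []ₛ = 1 , record
        { cell = λ _ _ → Unit.⊤ ; isOpen = λ _ _ → 1# , 0<1 , _ ; isConvex = λ _ _ _ _ _ _ → Unit.tt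
        ; nonempty = λ _ → 0ᵛ , Unit.tt ; disjoint = λ { {zero} {zero} _ _ → ≡.refl }
        ; covers = λ _ → zero , Unit.tt ; sound = λ _ () }
      open-partition-⋂ πs (outside ∷ₛ S) = let r , π = open-partition-⋂ (πs ∘ suc) S in
        r , open-partition-resp ((λ p → λ { (suc i) (there i∈) → p i i∈ }) , (λ p i i∈ → p (suc i) (there i∈))) π
      open-partition-⋂ πs (inside ∷ₛ S) =
        let r , π = open-partition-⋂ (πs ∘ suc) S
            s , ρ = open-partition-∩ (proj₂ (πs zero)) π
        in s , open-partition-resp
          ( (λ (p , q) → λ { zero here → p ; (suc i) (there i∈) → q i i∈ })
          , (λ p → p zero here , λ i i∈ → p (suc i) (there i∈)) ) ρ

-- Generic points, kernels and dimension

module LinearAlgebra (em : ExcludedMiddle (lsuc 0ℓ)) (ℝ : CompleteOrderedField) where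
  open CompleteOrderedField ℝ hiding (zero)
  open Reals em ℝ
  open Topology em ℝ
  open Linear
  open SemiringSum semiring
  open import Relation.Binary.Reasoning.Setoid setoid

  opaque
    sum-zero : ∀ {n} {f : Vector Carrier n} → (∀ i → f i ≈ 0#) → sum f ≈ 0#
    sum-zero {n} f≈0 = trans (sum-cong-≋ f≈0) (sum-replicate-zero n)

    sum-linear : ∀ {n} a b (f g : Vector Carrier n) →
                 sum (λ i → a * f i + b * g i) ≈ a * sum f + b * sum g
    sum-linear a b f g =
      trans (∑-distrib-+ (λ i → a * f i) (λ i → b * g i)) (sym (+-cong (*-distribˡ-sum a f) (*-distribˡ-sum b g)))

    -- Gaussian elimination of the first unknown, without division.
    underdetermined : ∀ e (M : Fin e → Vector Carrier (suc e)) →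
      Σ (Vector Carrier (suc e)) λ c → (∃[ t ] ¬ (c t ≈ 0#)) × (∀ i → sum (λ t → M i t * c t) ≈ 0#)
    underdetermined zero    M = (λ _ → 1#) , (zero , pos⇒≉0 0<1) , λ ()
    underdetermined (suc e) M with dec (∃[ i ] ¬ (M i zero ≈ 0#))
    ... | no ¬∃ = (1# ∷ᵛ λ _ → 0#) , (zero , pos⇒≉0 0<1) , λ i →
      trans (+-cong (trans (*-identityʳ _) (by-contradiction λ ≉0 → ¬∃ (i , ≉0)))
          (sum-zero λ t → zeroʳ (M i (suc t)))) (+-identityʳ 0#)
    ... | yes (i , p≉0) = c , (suc t , λ pc≈0 → c′t≉0 (*-zero-cancel p≉0 pc≈0)) , solves
      where
      p : Carrier
      p = M i zero
      M′ : Fin e → Vector Carrier (suc e)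
      M′ j t = p * M (punchIn i j) (suc t) + (- M (punchIn i j) zero) * M i (suc t)
      rest : Σ (Vector Carrier (suc e)) λ c → (∃[ t ] ¬ (c t ≈ 0#)) × (∀ i → sum (λ t → M′ i t * c t) ≈ 0#)
      rest = underdetermined e M′
      c′ : Vector Carrier (suc e)
      c′ = proj₁ rest
      t : Fin (suc e)
      t = proj₁ (proj₁ (proj₂ rest))
      c′t≉0 : ¬ (c′ t ≈ 0#)
      c′t≉0 = proj₂ (proj₁ (proj₂ rest))
      s : Fin (suc e) → Carrier
      s k = sum (λ t → M k (suc t) * c′ t)
      c : Vector Carrier (suc (suc e))
      c = (- s i) ∷ᵛ λ t → p * c′ t
      row : ∀ k → sum (λ t → M k t * c t) ≈ p * s k + (- M k zero) * s i
      row k = begin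
        M k zero * - s i + sum (λ t → M k (suc t) * (p * c′ t))
          ≈⟨ +-congˡ (trans (sum-cong-≋ λ t → solve 3 (λ m p c → m :* (p :* c) := p :* (m :* c)) refl
              (M k (suc t)) p (c′ t))
                            (sym (*-distribˡ-sum p (λ t → M k (suc t) * c′ t)))) ⟩
        M k zero * - s i + p * s k
          ≈⟨ solve 4 (λ m si p sk → m :* :- si :+ p :* sk := p :* sk :+ (:- m) :* si) refl (M k zero) (s i) p (s k) ⟩
        p * s k + (- M k zero) * s i ∎
      solves : ∀ k → sum (λ t → M k t * c t) ≈ 0#
      solves k with i Fin.≟ k
      ... | yes ≡.refl = trans (row k) (solve 2 (λ p s → p :* s :+ (:- p) :* s := :0) refl p (s k))
      ... | no  i≢k    = begin
        sum (λ t → M k t * c t)                                           ≈⟨ row k ⟩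
        p * s k + (- M k zero) * s i
          ≈⟨ sum-linear p (- M k zero) (λ t → M k (suc t) * c′ t) (λ t → M i (suc t) * c′ t) ⟨
        sum (λ t → p * (M k (suc t) * c′ t) + (- M k zero) * (M i (suc t) * c′ t))
          ≈⟨ sum-cong-≋ (λ t → solve 5 (λ p m c q n → p :* (m :* c) :+ (:- q) :* (n :* c) :=
              (p :* m :+ (:- q) :* n) :* c)
               refl p (M k (suc t)) (c′ t) (M k zero) (M i (suc t))) ⟩
        sum (λ t → (p * M k (suc t) + (- M k zero) * M i (suc t)) * c′ t)
          ≈⟨ ≡.subst (λ k → sum (λ t → (p * M k (suc t) + (- M k zero) * M i (suc t)) * c′ t) ≈ 0#)
               (Fin.punchIn-punchOut i≢k) (proj₂ (proj₂ rest) (punchOut i≢k)) ⟩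
        0# ∎

    unit : ∀ {d} → Fin d → Vector Carrier d
    unit zero    = 1# ∷ᵛ λ _ → 0#
    unit (suc s) = 0# ∷ᵛ unit s

    unit-same : ∀ {d} (s : Fin d) → unit s s ≈ 1#
    unit-same zero    = refl
    unit-same (suc s) = unit-same s

    unit-other : ∀ {d} {s t : Fin d} → s ≢ t → unit s t ≈ 0#
    unit-other {s = zero}  {zero}  s≢t = contradiction ≡.refl s≢t
    unit-other {s = zero}  {suc t} s≢t = refl
    unit-other {s = suc s} {zero}  s≢t = refl
    unit-other {s = suc s} {suc t} s≢t = unit-other (s≢t ∘ ≡.cong suc)

    unit-punchIn : ∀ {d} (p : Fin (suc d)) i j → unit (punchIn p i) (punchIn p j) ≈ unit i j
    unit-punchIn p i j with i Fin.≟ j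
    ... | yes ≡.refl = trans (unit-same (punchIn p i)) (sym (unit-same i))
    ... | no  i≢j    = trans (unit-other (i≢j ∘ Fin.punchIn-injective p i j)) (sym (unit-other i≢j))

    combination-unit : ∀ {d} (c : Vector Carrier d) s → sum (λ t → c t * unit t s) ≈ c s
    combination-unit c zero    =
      trans (+-cong (*-identityʳ _) (sum-zero λ t → zeroʳ (c (suc t)))) (+-identityʳ _)
    combination-unit c (suc s) =
      trans (+-cong (zeroʳ _) (combination-unit (tail c) s)) (+-identityˡ _)

  module _ {d : ℕ} where
    open Euclidean ℝ d

    Zero : (Point → Carrier) → Set
    Zero f = ∀ x → f x ≈ 0#

    opaque
      nonzero-at-unit : ∀ {f} → Linear f → ¬ Zero f → ∃[ t ] ¬ (f (unit t) ≈ 0#)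
      nonzero-at-unit {f} lf f≉0 = not-all λ f-unit≈0 → f≉0 λ x → begin
        f x                                ≈⟨ cong lf (λ s → combination-unit x s) ⟨
        f (linearCombination x unit)       ≈⟨ combination lf x unit ⟩
        sum (λ t → x t * f (unit t))       ≈⟨ sum-zero (λ t → trans (*-congˡ (f-unit≈0 t)) (zeroʳ _)) ⟩
        0#                                 ∎

      nonzero-stable : ∀ {a} c → ¬ (a ≈ 0#) → Small (λ δ → ¬ (a + δ * c ≈ 0#))
      nonzero-stable {a} c a≉0 with ≤-<-total a 0#
      ... | inj₂ 0<a = small-mono pos⇒≉0 (small-pos c 0<a)
      ... | inj₁ a≤0 = small-mono
        (λ {δ} 0< ≈0 → pos⇒≉0 0< (trans (solve 3 (λ a c δ → :- a :+ δ :* :- c := :0 :- (a :+ δ :* c)) refl a c δ)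
                                    (trans (+-congˡ (-‿cong ≈0)) (-‿inverseʳ 0#))))
        (small-pos (- c) (neg-pos (a≤0 , a≉0)))

      -- If the first form is nonzero but vanishes at the point v found for the others, move v by a
      -- small δ in a direction u where that form does not vanish: its value becomes δ times the one
      -- at u, and the other forms remain nonzero where they were.
      generic : ∀ {N} {L : Fin N → Point → Carrier} → (∀ i → Linear (L i)) →
                ∃[ v ] (∀ i → ¬ Zero (L i) → ¬ (L i v ≈ 0#))
      generic {zero}      linear = 0ᵛ , λ ()
      generic {suc N} {L} linear with generic (linear ∘ suc)
      ... | v , v-generic with dec (Zero (L zero) ⊎ ¬ (L zero v ≈ 0#))
      ...   | yes good = v , λ { zero → λ L≉0 → [ (λ L≈0 → contradiction L≈0 L≉0) , id ]′ good
                               ; (suc i) → v-generic i }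
      ...   | no  bad  =
        let u , Lu≉0 = not-all (bad ∘ inj₁)
            δ , 0<δ , stable = small-witness (small-all λ i → preserved u i)
        in (λ t → v t + δ * u t) , λ
          { zero    _    ≈0 → Lu≉0 (*-zero-cancel (pos⇒≉0 0<δ) (begin
              δ * L zero u                  ≈⟨ +-identityˡ _ ⟨
              0# + δ * L zero u             ≈⟨ +-congʳ (by-contradiction (bad ∘ inj₂)) ⟨
              L zero v + δ * L zero u       ≈⟨ affine (linear zero) v δ u ⟨
              L zero (λ t → v t + δ * u t)  ≈⟨ ≈0 ⟩
              0#                            ∎))
          ; (suc i) L≉0  ≈0 → stable i L≉0 (trans (sym (affine (linear (suc i)) v δ u)) ≈0) }
        where
        preserved : ∀ u i → Small (λ δ → ¬ Zero (L (suc i)) → ¬ (L (suc i) v + δ * L (suc i) u ≈ 0#))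
        preserved u i with dec (Zero (L (suc i)))
        ... | yes L≈0 = 1# , 0<1 , λ _ _ _ L≉0 → contradiction L≈0 L≉0
        ... | no  L≉0 = small-mono (λ p _ → p) (nonzero-stable (L (suc i) u) (v-generic i L≉0))

    infix 4 _~_
    _~_ : (Point → Carrier) → (Point → Carrier) → Set
    f ~ g = ∀ x → f x ≈ g x

    opaque
      separating : ∀ {k} {B : Fin k → Point → Carrier} → (∀ i → Linear (B i)) →
                   ∃[ v ] (∀ i j → ¬ (B i ~ B j) → ¬ (B i v ≈ B j v))
      separating {k} {B} linear =
        let v , v-generic = generic (λ n → linear-difference (linear (proj₁ (remQuot {k} k n)))
                (linear (proj₂ (remQuot {k} k n))))
        in v , λ i j i≁j Biv≈Bjv →
          ≡.subst (λ (i , j) → ¬ Zero (λ x → B i x - B j x) → ¬ (B i v - B j v ≈ 0#))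
            (Fin.remQuot-combine i j) (v-generic (combine i j))
            (λ zero-difference → i≁j λ x → difference-zero⇒≈ (zero-difference x))
            (trans (+-congʳ Biv≈Bjv) (-‿inverseʳ _))
        where
        difference-zero⇒≈ : ∀ {a b} → a - b ≈ 0# → a ≈ b
        difference-zero⇒≈ {a} {b} eq = trans (solve 2 (λ a b → a := b :+ (a :- b)) refl a b)
            (trans (+-congˡ eq) (+-identityʳ b))

  opaque
    argmax : ∀ {k} (P : Pred (Fin k) 0ℓ) (f : Fin k → Carrier) → ∃ P → ∃[ i ] P i × (∀ j → P j → f j ≤ f i)
    argmax {suc k} P f ∃P with dec (∃ (P ∘ suc))
    ... | no  none = zero , P0 ∃P , λ { zero _ → ≤-refl ; (suc j) p → contradiction (j , p) none }
      where
      P0 : ∃ P → P zero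
      P0 (zero  , p) = p
      P0 (suc j , p) = contradiction (j , p) none
    ... | yes some with argmax (P ∘ suc) (f ∘ suc) some
    ...   | i , p , max-i with dec (P zero) | ≤-<-total (f zero) (f (suc i))
    ...     | no ¬p  | _      = suc i , p , λ { zero p0 → contradiction p0 ¬p ; (suc j) → max-i j }
    ...     | yes p0 | inj₁ le = suc i , p , λ { zero _ → le ; (suc j) → max-i j }
    ...     | yes p0 | inj₂ gt = zero , p0 , λ { zero _ → ≤-refl ; (suc j) pj → ≤-trans (max-i j pj) (proj₁ gt) }

  module _ {n : ℕ} where
    open Euclidean ℝ (suc n)

    opaque
      -- P need not be a subspace: it will be a polyhedral cone spanning the kernel. With a pivot p
      -- such that ℓ(e_p) is nonzero, the basis consists of e_i - (ℓ(e_i) / ℓ(e_p)) e_p for i other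
      -- than p. Coordinates away from p recover the coefficients; what remains of a kernel vector
      -- is a multiple of e_p in the kernel, hence zero.
      kernel-dimension : ∀ {ℓ} → Linear ℓ → ¬ Zero ℓ → ∀ {P : Pred Point 0ℓ} →
        (∀ {x} → P x → ℓ x ≈ 0#) → (∀ x → ℓ x ≈ 0# → Span P x) → HasDimension P n
      kernel-dimension {ℓ} lℓ ℓ≉0 {P} P⊆ker ker⊆span =
        b , (λ i → ker⊆span (b i) (b∈ker i)) , independent , spanning
        where
        pivot : Fin (suc n)
        pivot = proj₁ (nonzero-at-unit lℓ ℓ≉0)
        ℓp≉0 : ¬ (ℓ (unit pivot) ≈ 0#)
        ℓp≉0 = proj₂ (nonzero-at-unit lℓ ℓ≉0)
        q : Carrier
        q = proj₁ (inverse _ ℓp≉0)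
        ℓp*q≈1 : ℓ (unit pivot) * q ≈ 1#
        ℓp*q≈1 = proj₂ (inverse _ ℓp≉0)
        b : Vector Point n
        b i t = unit (punchIn pivot i) t + (- (ℓ (unit (punchIn pivot i)) * q)) * unit pivot t
        b∈ker : ∀ i → ℓ (b i) ≈ 0#
        b∈ker i = begin
          ℓ (b i)                          ≈⟨ affine lℓ _ _ _ ⟩
          a + (- (a * q)) * ℓ (unit pivot)
            ≈⟨ solve 3 (λ a q p → a :+ (:- (a :* q)) :* p := a :- a :* (p :* q)) refl a q (ℓ (unit pivot)) ⟩
          a - a * (ℓ (unit pivot) * q)     ≈⟨ +-congˡ (-‿cong (trans (*-congˡ ℓp*q≈1) (*-identityʳ a))) ⟩
          a - a                            ≈⟨ -‿inverseʳ a ⟩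
          0#                               ∎
          where
          a : Carrier
          a = ℓ (unit (punchIn pivot i))
        b-punchIn : ∀ i j → b i (punchIn pivot j) ≈ unit i j
        b-punchIn i j = trans (+-cong (unit-punchIn pivot i j)
          (trans (*-congˡ (unit-other (Fin.punchInᵢ≢i pivot j ∘ ≡.sym))) (zeroʳ _))) (+-identityʳ _)
        coordinate : ∀ c j → linearCombination c b (punchIn pivot j) ≈ c j
        coordinate c j = trans (sum-cong-≋ λ i → *-congˡ (b-punchIn i j)) (combination-unit c j)
        independent : LinearlyIndependent b
        independent c cb≋0 j = trans (sym (coordinate c j)) (cb≋0 (punchIn pivot j))
        P-span⊆ker : ∀ {x} → Span P x → ℓ x ≈ 0#
        P-span⊆ker (_ , c , v , v∈P , x≋) = trans (cong lℓ x≋) (trans (combination lℓ c v)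
          (sum-zero λ i → trans (*-congˡ (P⊆ker (v∈P i))) (zeroʳ _)))
        spanning : ∀ {x} → Span P x → ∃[ c ] x ≋ linearCombination c b
        spanning {x} x∈ = c , λ t → begin
          x t                                 ≈⟨ solve 2 (λ x y → x := y :+ (x :- y)) refl (x t) (y t) ⟩
          y t + (x t - y t)                   ≈⟨ +-congˡ (residue t) ⟩
          y t + 0#                            ≈⟨ +-identityʳ _ ⟩
          y t                                 ∎
          where
          c : Vector Carrier n
          c i = x (punchIn pivot i)
          y : Point
          y = linearCombination c b
          z : Point
          z t = x t - y t
          z-punchIn : ∀ j → z (punchIn pivot j) ≈ 0#
          z-punchIn j = trans (+-congˡ (-‿cong (coordinate c j))) (-‿inverseʳ _)
          z-parallel : ∀ t → z t ≈ z pivot * unit pivot t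
          z-parallel t with pivot Fin.≟ t
          ... | yes ≡.refl = sym (trans (*-congˡ (unit-same t)) (*-identityʳ _))
          ... | no  p≢t    = trans (≡.subst (λ t → z t ≈ 0#) (Fin.punchIn-punchOut p≢t) (z-punchIn (punchOut p≢t)))
                               (sym (trans (*-congˡ (unit-other p≢t)) (zeroʳ _)))
          ℓz≈0 : ℓ z ≈ 0#
          ℓz≈0 = begin
            ℓ z             ≈⟨ solve 2 (λ z y → z := y :+ z :- y) refl (ℓ z) (ℓ y) ⟩
            ℓ y + ℓ z - ℓ y ≈⟨ +-congʳ (sym (difference lℓ y x)) ⟩
            ℓ x - ℓ y       ≈⟨ +-cong (P-span⊆ker x∈) (-‿cong ℓy≈0) ⟩
            0# - 0#         ≈⟨ -‿inverseʳ 0# ⟩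
            0#              ∎
            where
            ℓy≈0 : ℓ y ≈ 0#
            ℓy≈0 = trans (combination lℓ c b) (sum-zero λ i → trans (*-congˡ (b∈ker i)) (zeroʳ _))
          z-pivot : z pivot ≈ 0#
          z-pivot = *-zero-cancel ℓp≉0 (begin
            ℓ (unit pivot) * z pivot             ≈⟨ *-comm _ _ ⟩
            z pivot * ℓ (unit pivot)             ≈⟨ homogeneous lℓ (z pivot) (unit pivot) ⟨
            ℓ (λ t → z pivot * unit pivot t)     ≈⟨ cong lℓ z-parallel ⟨
            ℓ z                                  ≈⟨ ℓz≈0 ⟩
            0#                                   ∎)
          residue : ∀ t → z t ≈ 0#
          residue t = trans (z-parallel t) (trans (*-congʳ z-pivot) (zeroˡ _))

      -- The coefficients of the n + 1 unit vectors over n spanning vectors form an underdetermined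
      -- system. A nonzero solution c would satisfy c = Σ c_t e_t = 0.
      not-spanning : ∀ (b : Vector Point n) → ¬ (∀ x → ∃[ c ] x ≋ linearCombination c b)
      not-spanning b spans = c-s≉0 (begin
        c s                                                   ≈⟨ combination-unit c s ⟨
        sum (λ t → c t * unit t s)
          ≈⟨ sum-cong-≋ (λ t → *-congˡ {c t} (proj₂ (spans (unit t)) s)) ⟩
        sum (λ t → c t * sum (λ i → C t i * b i s))
          ≈⟨ sum-cong-≋ (λ t → *-distribˡ-sum (c t) (λ i → C t i * b i s)) ⟩
        sum (λ t → sum (λ i → c t * (C t i * b i s)))         ≈⟨ ∑-comm (λ t i → c t * (C t i * b i s)) ⟩
        sum (λ i → sum (λ t → c t * (C t i * b i s)))         ≈⟨ sum-zero column ⟩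
        0#                                                    ∎)
        where
        C : Fin (suc n) → Vector Carrier n
        C t = proj₁ (spans (unit t))
        solution : Σ (Vector Carrier (suc n)) λ c → (∃[ t ] ¬ (c t ≈ 0#)) × (∀ i → sum (λ t → C t i * c t) ≈ 0#)
        solution = underdetermined n (λ i t → C t i)
        c : Vector Carrier (suc n)
        c = proj₁ solution
        s : Fin (suc n)
        s = proj₁ (proj₁ (proj₂ solution))
        c-s≉0 : ¬ (c s ≈ 0#)
        c-s≉0 = proj₂ (proj₁ (proj₂ solution))
        column : ∀ i → sum (λ t → c t * (C t i * b i s)) ≈ 0#
        column i = begin
          sum (λ t → c t * (C t i * b i s))
            ≈⟨ sum-cong-≋ (λ t → solve 3 (λ c m b → c :* (m :* b) := b :* (m :* c)) refl (c t) (C t i) (b i s)) ⟩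
          sum (λ t → b i s * (C t i * c t))        ≈⟨ *-distribˡ-sum (b i s) (λ t → C t i * c t) ⟨
          b i s * sum (λ t → C t i * c t)          ≈⟨ *-congˡ (proj₂ (proj₂ solution) i) ⟩
          b i s * 0#                               ≈⟨ zeroʳ _ ⟩
          0#                                       ∎

      -- z is the difference of the two points w + δz and w of P, divided by δ. Thus a point from
      -- which P extends in a direction puts that direction into the span.
      direction-in-span : ∀ {P : Pred Point 0ℓ} {w} → P w → ∀ z → Small (λ δ → P (λ t → w t + δ * z t)) → Span P z
      direction-in-span {P} {w} w∈ z near =
        let δ , 0<δ , u∈ = small-witness near
            i , _ , δi≈1 = pos-inverse 0<δ
        in 2 , (i ∷ᵛ (- i) ∷ᵛ []ᵛ) , ((λ t → w t + δ * z t) ∷ᵛ w ∷ᵛ []ᵛ)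
         , (λ { zero → u∈ ; (suc zero) → w∈ })
         , λ t → begin
           z t                                                 ≈⟨ *-identityˡ _ ⟨
           1# * z t                                            ≈⟨ *-congʳ δi≈1 ⟨
           δ * i * z t                                         ≈⟨ solve 4 (λ δ i z w → δ :* i :* z
                                                                    := i :* (w :+ δ :* z) :+ ((:- i) :* w :+ :0))
                                                                  refl δ i (z t) (w t) ⟩
           i * (w t + δ * z t) + ((- i) * w t + 0#)            ∎

-- A single maxout unit: creases, facets and linear regions

module MaxoutUnit (em : ExcludedMiddle (lsuc 0ℓ)) (ℝ : CompleteOrderedField) (n : ℕ) where
  open CompleteOrderedField ℝ hiding (zero)
  open Reals em ℝ
  open Topology em ℝ
  open LinearAlgebra em ℝ
  open Linear
  open Euclidean ℝ (suc n)

  linear : (A : LinearFunction) → Linear ⟦ A ⟧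
  linear A = record { cong = ⟦⟧-cong ; additive = +ᴹ-homo ; homogeneous = *ₗ-homo }
    where
    open LinearFunction A using (isLinear)
    open ModuleMorphisms.LeftModuleMorphisms.IsLeftModuleHomomorphism isLinear using (⟦⟧-cong; +ᴹ-homo; *ₗ-homo)

  module _ {k : ℕ} (B : Fin k → Point → Carrier) (linear-B : ∀ c → Linear (B c)) where

    Active : Point → Fin k → Set
    Active x a = ∀ c → B c x ≤ B a x

    -- The two functions must differ as functions, not merely in their index: copies of one function
    -- tie even where the maximum is locally linear.
    NonSmooth : Pred Point 0ℓ
    NonSmooth x = ∃[ a ] ∃[ b ] ¬ (B a ~ B b) × Active x a × Active x b

    Common : Fin k → Fin k → Pred Point 0ℓ
    Common a b x = B a x ≈ B b x × Active x a

    private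
      D : Fin k → Fin k → Point → Carrier
      D a c z = B c z - B a z

      linear-D : ∀ a c → Linear (D a c)
      linear-D a c = linear-difference (linear-B c) (linear-B a)

      D-zero : ∀ {a c z} → B c z ≈ B a z → D a c z ≈ 0#
      D-zero eq = trans (+-congʳ eq) (-‿inverseʳ _)

      D-zero⁻¹ : ∀ {a c z} → D a c z ≈ 0# → B c z ≈ B a z
      D-zero⁻¹ {a} {c} {z} eq = trans (solve 2 (λ a c → c := a :+ (c :- a)) refl (B a z) (B c z))
                                  (trans (+-congˡ eq) (+-identityʳ _))

      D-neg : ∀ {a c z} → B c z < B a z → D a c z < 0#
      D-neg {a} {c} {z} lt = 0<⇒< (<-respʳ (solve 2 (λ a c → a :- c := :0 :- (c :- a)) refl (B a z) (B c z)) (<⇒0< lt))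

      D-nonpos⁻¹ : ∀ {a c z} → D a c z ≤ 0# → B c z ≤ B a z
      D-nonpos⁻¹ {a} {c} {z} le = 0≤⇒≤
          (≤-respʳ (solve 2 (λ a c → :0 :- (c :- a) := a :- c) refl (B a z) (B c z)) (≤⇒0≤ le))

      active-value : ∀ {x a b} → Active x a → Active x b → B a x ≈ B b x
      active-value {x} {a} {b} act-a act-b = antisym (act-b a) (act-a b)

    -- w lies in the relative interior of a facet common to the regions of a and b.
    record Facet (x : Point) : Set where
      field
        a b        : Fin k
        distinct   : ¬ (B a ~ B b)
        active-a   : Active x a
        active-b   : Active x b
        w          : Point
        w-tie      : D a b w ≈ 0#
        w-dominant : ∀ c → D a c w < 0# ⊎ (D a c w ≈ 0# × (∀ z → D a b z ≈ 0# → D a c z ≈ 0#))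

    opaque
      -- Let a be the maximiser over the active functions at a generic y₀, scale
      -- each D a c to take the value −1 at y₀, and let b maximise the scaled
      -- functions at a generic v, with maximum ρ.  At y = ρ y₀ + v the functions
      -- a and b tie, and any further tie is with a scalar multiple of D a b.
      facet : ∀ {x} → NonSmooth x → Facet x
      facet {x} (a₁ , b₁ , a₁≁b₁ , act-a₁ , act-b₁) = record
        { a = a ; b = b ; distinct = λ a~b → proj₂ good-b (sym ∘ a~b) ; active-a = active-a ; active-b = proj₁ good-b
        ; w = w
        ; w-tie = trans (active-w b (proj₁ good-b)) (trans (*-congˡ (tie-b)) (zeroʳ η))
        ; w-dominant = dominant
        }
        where
        open import Relation.Binary.Reasoning.Setoid setoid
        y₀ : Point
        y₀ = proj₁ (separating linear-B)
        y₀-separates : ∀ i j → ¬ (B i ~ B j) → ¬ (B i y₀ ≈ B j y₀)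
        y₀-separates = proj₂ (separating linear-B)
        top : ∃[ a ] Active x a × (∀ c → Active x c → B c y₀ ≤ B a y₀)
        top = argmax (Active x) (λ c → B c y₀) (a₁ , act-a₁)
        a : Fin k
        a = proj₁ top
        active-a : Active x a
        active-a = proj₁ (proj₂ top)
        a-max : ∀ c → Active x c → B c y₀ ≤ B a y₀
        a-max = proj₂ (proj₂ top)
        Good : Pred (Fin k) 0ℓ
        Good c = Active x c × ¬ (B c ~ B a)
        some-good : ∃ Good
        some-good with dec (B a₁ ~ B a)
        ... | no  a₁≁a = a₁ , act-a₁ , a₁≁a
        ... | yes a₁~a = b₁ , act-b₁ , λ b₁~a → a₁≁b₁ λ z → trans (a₁~a z) (sym (b₁~a z))
        α : Fin k → Carrier
        α c = - D a c y₀
        0<α : ∀ {c} → Good c → 0# < α c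
        0<α {c} (act , c≁a) = neg-pos (D-neg (a-max c act , y₀-separates c a c≁a))
        -- Outside `Good` the factor is a dummy 0; `best` compares good indices only.
        scaling : ∀ c → ∃[ ι ] (Good c → α c * ι ≈ 1#)
        scaling c with dec (Good c)
        ... | yes good = let ι , _ , eq = pos-inverse (0<α good) in ι , λ _ → eq
        ... | no  bad  = 0# , λ good → contradiction good bad
        ι : Fin k → Carrier
        ι = proj₁ ∘ scaling
        E : Fin k → Point → Carrier
        E c z = ι c * D a c z
        D≈αE : ∀ {c} → Good c → ∀ z → D a c z ≈ α c * E c z
        D≈αE {c} good z = begin
          D a c z                  ≈⟨ *-identityˡ _ ⟨
          1# * D a c z             ≈⟨ *-congʳ (proj₂ (scaling c) good) ⟨
          α c * ι c * D a c z      ≈⟨ *-assoc _ _ _ ⟩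
          α c * E c z              ∎
        linear-E : ∀ c → Linear (E c)
        linear-E c = linear-scale (ι c) (linear-D a c)
        v : Point
        v = proj₁ (separating linear-E)
        v-separates : ∀ i j → ¬ (E i ~ E j) → ¬ (E i v ≈ E j v)
        v-separates = proj₂ (separating linear-E)
        best : ∃[ b ] Good b × (∀ c → Good c → E c v ≤ E b v)
        best = argmax Good (λ c → E c v) some-good
        b : Fin k
        b = proj₁ best
        good-b : Good b
        good-b = proj₁ (proj₂ best)
        b-max : ∀ c → Good c → E c v ≤ E b v
        b-max = proj₂ (proj₂ best)
        ρ : Carrier
        ρ = E b v
        y : Point
        y t = v t + ρ * y₀ t
        D-y : ∀ {c} → Good c → D a c y ≈ α c * (E c v - ρ)
        D-y {c} good = begin
          D a c y                          ≈⟨ affine (linear-D a c) v ρ y₀ ⟩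
          D a c v + ρ * D a c y₀           ≈⟨ +-congʳ (D≈αE good v) ⟩
          α c * E c v + ρ * D a c y₀
            ≈⟨ solve 3 (λ e ρ d → (:- d) :* e :+ ρ :* d := (:- d) :* (e :- ρ)) refl (E c v) ρ (D a c y₀) ⟩
          α c * (E c v - ρ)                ∎
        tie-b : D a b y ≈ 0#
        tie-b = trans (D-y good-b) (trans (*-congˡ (-‿inverseʳ ρ)) (zeroʳ _))
        -- Functions active at x tie there with a, so on the way from x along y their sign is
        -- decided by y alone. The inactive ones are strictly below at x and remain so for a short
        -- step.
        perturbation : ∃[ δ ] 0# < δ × (∀ c → D a c x < 0# → D a c x + δ * D a c y < 0#)
        perturbation = small-witness (small-all λ c → remains-negative c)
          where
          remains-negative : ∀ c → Small (λ δ → D a c x < 0# → D a c x + δ * D a c y < 0#)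
          remains-negative c = decide (dec (D a c x < 0#))
            where
            decide : Dec (D a c x < 0#) → Small (λ δ → D a c x < 0# → D a c x + δ * D a c y < 0#)
            decide (no ≮0)  = 1# , 0<1 , λ _ _ _ lt → contradiction lt ≮0
            decide (yes lt) = small-mono
              (λ {δ} 0< _ → 0<⇒< (<-respʳ (solve 3 (λ d δ e → :- d :+ δ :* (:- e) := :0 :- (d :+ δ :* e))
                  refl (D a c x) δ (D a c y)) 0<))
              (small-pos (- D a c y) (neg-pos lt))
        η : Carrier
        η = proj₁ perturbation
        0<η : 0# < η
        0<η = proj₁ (proj₂ perturbation)
        w : Point
        w t = x t + η * y t
        active-w : ∀ c → Active x c → D a c w ≈ η * D a c y
        active-w c act = trans (affine (linear-D a c) x η y)
          (trans (+-congʳ (D-zero (active-value act active-a))) (+-identityˡ _))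
        dominant : ∀ c → D a c w < 0# ⊎ (D a c w ≈ 0# × (∀ z → D a b z ≈ 0# → D a c z ≈ 0#))
        dominant c = decide (dec (Active x c)) (dec (B c ~ B a)) (dec (E c v ≈ ρ))
          where
          neg-product : ∀ {p q} → 0# < p → q < 0# → p * q < 0#
          neg-product {p} {q} 0<p q<0 =
            0<⇒< (<-respʳ (solve 2 (λ p q → p :* (:- q) := :0 :- p :* q) refl p q) (*-pos 0<p (neg-pos q<0)))
          decide : Dec (Active x c) → Dec (B c ~ B a) → Dec (E c v ≈ ρ) →
                   D a c w < 0# ⊎ (D a c w ≈ 0# × (∀ z → D a b z ≈ 0# → D a c z ≈ 0#))
          decide _         (yes c~a) _ = inj₂ (D-zero (c~a w) , λ z _ → D-zero (c~a z))
          decide (no ¬act) (no _)    _ = inj₁ (<-respˡ (sym (affine (linear-D a c) x η y))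
            (proj₂ (proj₂ perturbation) c (D-neg (active-a c , λ eq → ¬act λ c′ → ≤-respʳ (sym eq) (active-a c′)))))
          decide (yes act) (no c≁a) (no ≉ρ) = inj₁ (<-respˡ (sym (active-w c act)) (neg-product 0<η
            (<-respˡ (sym (D-y good)) (neg-product (0<α good) (0<⇒< (<-respʳ
              (solve 2 (λ e ρ → ρ :- e := :0 :- (e :- ρ)) refl (E c v) ρ) (<⇒0< (b-max c good , ≉ρ))))))))
            where
            good : Good c
            good = act , c≁a
          decide (yes act) (no c≁a) (yes ≈ρ) = inj₂
            ( trans (active-w c act) (trans (*-congˡ (trans (D-y good)
                (trans (*-congˡ (trans (+-congʳ ≈ρ) (-‿inverseʳ ρ))) (zeroʳ _)))) (zeroʳ η))
            , λ z Db≈0 → begin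
                D a c z       ≈⟨ D≈αE good z ⟩
                α c * E c z   ≈⟨ *-congˡ (E-eq z) ⟩
                α c * E b z   ≈⟨ *-congˡ (trans (*-congˡ Db≈0) (zeroʳ _)) ⟩
                α c * 0#      ≈⟨ zeroʳ _ ⟩
                0#            ∎ )
            where
            good : Good c
            good = act , c≁a
            E-eq : E c ~ E b
            E-eq = by-contradiction λ ≁ → v-separates c b ≁ ≈ρ

      -- The tie set lies in the kernel of `D a b`. Conversely, w can be moved a little along any z
      -- of this kernel: functions strictly below a at w remain below, and by `w-dominant` the
      -- others keep their tie because their difference from a vanishes at z too. So the tie set
      -- spans the kernel.
      facet-codimension : ∀ {x} (F : Facet x) → HasCodimension (Common (Facet.a F) (Facet.b F)) 1
      facet-codimension F = n , kernel-dimension (linear-D a b) nonzero {P = Common a b}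
          (λ (eq , _) → D-zero (sym eq)) ker⊆span , ℕ.+-comm n 1
        where
        open Facet F
        nonzero : ¬ Zero (D a b)
        nonzero D≈0 = distinct λ z → sym (D-zero⁻¹ (D≈0 z))
        w∈ : Common a b w
        w∈ = sym (D-zero⁻¹ w-tie)
           , λ c → D-nonpos⁻¹ ([ proj₁ , (λ (eq , _) → ≤-reflexive eq) ]′ (w-dominant c))
        ker⊆span : ∀ z → D a b z ≈ 0# → Span (Common a b) z
        ker⊆span z Dz≈0 = direction-in-span {P = Common a b} w∈ z (small-mono
          (λ {δ} below → sym (D-zero⁻¹ (trans (affine (linear-D a b) w δ z)
                               (trans (+-cong w-tie (trans (*-congˡ Dz≈0) (zeroʳ δ))) (+-identityˡ 0#))))
                 , λ c → D-nonpos⁻¹ (≤-respˡ (sym (affine (linear-D a c) w δ z)) (below c)))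
          (small-all nonpositive))
          where
          nonpositive : ∀ c → Small (λ δ → D a c w + δ * D a c z ≤ 0#)
          nonpositive c with w-dominant c
          ... | inj₁ lt       = small-mono
            (λ {δ} 0< → 0≤⇒≤ (≤-respʳ (solve 3 (λ d δ e → :- d :+ δ :* (:- e) := :0 :- (d :+ δ :* e)) refl
                (D a c w) δ (D a c z)) (proj₁ 0<)))
            (small-pos (- D a c z) (neg-pos lt))
          ... | inj₂ (eq , D⇒) = 1# , 0<1 , λ δ _ _ → ≤-reflexive
              (trans (+-cong eq (trans (*-congˡ (D⇒ z Dz≈0)) (zeroʳ δ))) (+-identityˡ 0#))

      -- If x were smooth, b and every other function active at x would be a copy of a, and the
      -- remaining ones would stay below a near x. The tie set would then contain a neighbourhood of
      -- x and span the whole space, which n vectors cannot do.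
      codimension-one⇒nonsmooth : ∀ {a b x} → a ≢ b → HasCodimension (Common a b) 1 → Common a b x → NonSmooth x
      codimension-one⇒nonsmooth {a} {b} {x} a≢b (e , (basis , _ , _ , spanning) , e+1≡) x∈@(tie , act-a) =
        by-contradiction λ smooth →
          let near : Near x (Common a b)
              near = near-mono (λ {y} dom → sym (b~a smooth y) , dom)
                       (near-all {x = x} (dominated smooth))
          in not-spanning′ e (ℕ.suc-injective (≡.trans (≡.sym (ℕ.+-comm e 1)) e+1≡)) basis λ z →
               spanning (direction-in-span {P = Common a b} x∈ z (near-line {x = x} near z))
        where
        not-spanning′ : ∀ e → e ≡ n → (b : Fin e → Point) → ¬ (∀ x → ∃[ c ] x ≋ linearCombination c b)
        not-spanning′ e ≡.refl = not-spanning
        act-b : Active x b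
        act-b c = ≤-respʳ tie (act-a c)
        similar : ¬ NonSmooth x → ∀ {c} → Active x c → B c ~ B a
        similar smooth {c} act = by-contradiction λ c≁a → smooth (c , a , c≁a , act , act-a)
        b~a : ¬ NonSmooth x → B b ~ B a
        b~a smooth = similar smooth act-b
        dominated : ¬ NonSmooth x → ∀ c → Near x (λ y → B c y ≤ B a y)
        dominated smooth c with dec (B c ~ B a)
        ... | yes c~a = 1# , 0<1 , λ {y} _ → ≤-reflexive (c~a y)
        ... | no  c≁a = near-mono proj₁ (near-< (linear-B c) (linear-B a) {x}
                (act-a c , λ eq → c≁a (similar smooth λ c′ → ≤-respʳ (sym eq) (act-a c′))))

      -- The linear region of a. Copies of a are exempt from the comparison, so they share one
      -- region, and a function that is nowhere strictly maximal has an empty one; `open-partition`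
      -- sorts out both.
      Dominant : Fin k → Pred Point 0ℓ
      Dominant a x = ∀ c → ¬ (B c ~ B a) → B c x < B a x

      dominant-open : ∀ a → Open (Dominant a)
      dominant-open a {x} dominant = near-all {x = x} separate
        where
        separate : ∀ c → Near x (λ y → ¬ (B c ~ B a) → B c y < B a y)
        separate c with dec (B c ~ B a)
        ... | yes c~a = 1# , 0<1 , λ _ c≁a → contradiction c~a c≁a
        ... | no  c≁a = near-mono (λ p _ → p) (near-< (linear-B c) (linear-B a) {x} (dominant c c≁a))

      dominant-convex : ∀ a → Convex (Dominant a)
      dominant-convex a {x} {y} dom-x dom-y {p} {q} 0≤p 0≤q p+q≈1 c c≁a = 0<⇒< (<-respʳ eq
        (weighted (<⇒0< (dom-x c c≁a)) (<⇒0< (dom-y c c≁a))))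
        where
        value : ∀ c → B c (λ t → p * x t + q * y t) ≈ p * B c x + q * B c y
        value c = trans (additive (linear-B c) _ _)
            (+-cong (homogeneous (linear-B c) p x) (homogeneous (linear-B c) q y))
        eq : p * (B a x - B c x) + q * (B a y - B c y) ≈ B a (λ t → p * x t + q * y t) - B c (λ t → p * x t + q * y t)
        eq = trans (solve 6 (λ p q u v r s → p :* (u :- v) :+ q :* (r :- s) := (p :* u :+ q :* r) :- (p :* v :+ q :* s))
                     refl p q (B a x) (B c x) (B a y) (B c y))
               (sym (+-cong (value a) (-‿cong (value c))))
        -- One weight may vanish, but not both: if p is 0, then q is 1.
        weighted : ∀ {u v} → 0# < u → 0# < v → 0# < p * u + q * v
        weighted {u} {v} 0<u 0<v with dec (0# ≈ p)
        ... | no  0≉p = +-pos-nonneg (*-pos (0≤p , 0≉p) 0<u) (*-nonneg 0≤q (proj₁ 0<v))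
        ... | yes 0≈p = <-respʳ (sym (trans (+-cong (trans (*-congʳ (sym 0≈p)) (zeroˡ u))
                (trans (*-congʳ (trans (sym (+-identityˡ q)) (trans (+-congʳ 0≈p) p+q≈1)))
                    (*-identityˡ v))) (+-identityˡ v))) 0<v

      -- Two different functions cannot strictly exceed each other at x, so regions that meet belong
      -- to copies of one function.
      dominant-coincide : ∀ {a b x} → Dominant a x → Dominant b x → Dominant a ⊆ Dominant b
      dominant-coincide {a} {b} {x} dom-a dom-b {y} dom c c≁b =
        <-respʳ (a~b y) (dom c λ c~a → c≁b λ z → trans (c~a z) (a~b z))
        where
        a~b : B a ~ B b
        a~b = by-contradiction λ a≁b → <⇒≱ (dom-a b (λ b~a → a≁b (sym ∘ b~a))) (proj₁ (dom-b a a≁b))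

      smooth⇔dominant : Fin k → (λ x → ∃[ a ] Dominant a x) ≐ ∁ NonSmooth
      smooth⇔dominant c₀ =
        (λ (a , dom) (b , c , b≁c , act-b , act-c) → b≁c λ z → trans (top dom act-b z) (sym (top dom act-c z)))
        , λ {x} smooth →
            let a , _ , max-a = argmax (λ _ → Fin k) (λ c → B c x) (c₀ , c₀)
                act-a = λ c → max-a c c₀
            in a , λ c c≁a → act-a c , λ eq → smooth (c , a , c≁a , (λ c′ → ≤-respʳ (sym eq) (act-a c′)) , act-a)
        where
        top : ∀ {a b x} → Dominant a x → Active x b → B b ~ B a
        top {a} {b} dom act = by-contradiction λ b≁a → <⇒≱ (dom b b≁a) (act a)

      smooth-partition : Fin k → ∃ (OpenPartition (∁ NonSmooth))
      smooth-partition c₀ =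
        let r , π = open-partition Dominant dominant-open dominant-convex dominant-coincide
        in r , open-partition-resp (smooth⇔dominant c₀) π

      zero-active : ∀ {x} → x ≋ 0ᵛ → ∀ a → Active x a
      zero-active {x} x≋0 a c = ≤-reflexive (trans (vanish c) (sym (vanish a)))
        where
        vanish : ∀ c → B c x ≈ 0#
        vanish c = trans (cong (linear-B c) x≋0) (zero-value (linear-B c))

-- Integration with respect to the Euler characteristic

module Integration (em : ExcludedMiddle (lsuc 0ℓ)) (ℝ : CompleteOrderedField) where
  open CompleteOrderedField ℝ hiding (zero)
  open Reals em ℝ
  open Topology em ℝ

  opaque
    indicator : Set → ℤ
    indicator P with dec P
    ... | yes _ = 1ℤ
    ... | no  _ = 0ℤ

    indicator-yes : ∀ {P} → P → indicator P ≡ 1ℤ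
    indicator-yes {P} p with dec P
    ... | yes _ = ≡.refl
    ... | no ¬p = contradiction p ¬p

    indicator-no : ∀ {P} → ¬ P → indicator P ≡ 0ℤ
    indicator-no {P} ¬p with dec P
    ... | yes p = contradiction p ¬p
    ... | no _  = ≡.refl

  indicator-cong : ∀ {P Q} → (P → Q) → (Q → P) → indicator P ≡ indicator Q
  indicator-cong {P} to from with dec P
  ... | yes p = ≡.trans (indicator-yes p) (≡.sym (indicator-yes (to p)))
  ... | no ¬p = ≡.trans (indicator-no ¬p) (≡.sym (indicator-no (¬p ∘ from)))

  indicator-× : ∀ {P Q} → indicator (P × Q) ≡ indicator P ℤ.* indicator Q
  indicator-× {P} {Q} with dec P
  ... | yes p = ≡.trans (indicator-cong proj₂ (p ,_))
                  (≡.trans (≡.sym (ℤ.*-identityˡ _)) (≡.cong (ℤ._* indicator Q) (≡.sym (indicator-yes p))))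
  ... | no ¬p = ≡.trans (indicator-no (¬p ∘ proj₁)) (≡.cong (ℤ._* indicator Q) (≡.sym (indicator-no ¬p)))

  -- The integral with respect to the Euler characteristic, up to sign: every
  -- admissible set has measure 1.
  data Integral {X : Set} (Admissible : Pred X 0ℓ → Set) : (X → ℤ) → ℤ → Set₁ where
    cell  : ∀ {P} → Admissible P → Integral Admissible (λ x → indicator (P x)) 1ℤ
    none  : Integral Admissible (λ _ → 0ℤ) 0ℤ
    add   : ∀ {f g u v} → Integral Admissible f u → Integral Admissible g v →
            Integral Admissible (λ x → f x ℤ.+ g x) (u ℤ.+ v)
    scale : ∀ {f u} c → Integral Admissible f u → Integral Admissible (λ x → c ℤ.* f x) (c ℤ.* u)
    resp  : ∀ {f g u} → (∀ x → f x ≡ g x) → Integral Admissible f u → Integral Admissible g u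

  -- The line: right endpoints and jumps

  record Interval (I : Pred Carrier 0ℓ) : Set where
    field
      isOpen   : ∀ {t} → I t → ∃[ ε ] 0# < ε × (∀ {s} → t - ε < s → s < t + ε → I s)
      convex   : ∀ {s t z} → I s → I t → s ≤ z → z ≤ t → I z
      nonempty : ∃ I

  ConvexOpen : ∀ {d} → Pred (Vector Carrier d) 0ℓ → Set
  ConvexOpen {d} P = Euclidean.Open ℝ d P × Convex P × ∃ P

  -- The position of a right endpoint; nothing stands for +∞.
  Key : Set
  Key = Maybe Carrier

  infix 4 _≈ᴷ_ _<ᴷ_
  _≈ᴷ_ : Key → Key → Set
  _≈ᴷ_ = Pointwise _≈_

  _<ᴷ_ : Carrier → Key → Set
  s <ᴷ just t  = s < t
  s <ᴷ nothing = Unit.⊤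

  -- The filter of left neighbourhoods of κ, or of neighbourhoods of +∞ if κ is `nothing`. It
  -- expresses left limits of integer-valued functions without a notion of limit.
  Below : Key → Pred Carrier 0ℓ → Set
  Below κ P = ∃[ u ] u <ᴷ κ × (∀ {s} → u < s → s <ᴷ κ → P s)

  below-∩ : ∀ {κ P Q} → Below κ P → Below κ Q → Below κ (P ∩ Q)
  below-∩ (u , u<κ , p) (u′ , u′<κ , q) with total u u′
  ... | inj₁ u≤u′ = u′ , u′<κ , λ u′<s s<κ → p (≤-<-trans u≤u′ u′<s) s<κ , q u′<s s<κ
  ... | inj₂ u′≤u = u , u<κ , λ u<s s<κ → p u<s s<κ , q (≤-<-trans u′≤u u<s) s<κ

  below-mono : ∀ {κ P Q} → (∀ {s} → P s → Q s) → Below κ P → Below κ Q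
  below-mono P⊆Q (u , u<κ , p) = u , u<κ , λ u<s s<κ → P⊆Q (p u<s s<κ)

  below-witness : ∀ {κ P} → Below κ P → ∃ P
  below-witness {just t}  (u , u<t , p) = let s , u<s , s<t = dense u<t in s , p u<s s<t
  below-witness {nothing} (u , _ , p)   = u + 1# , p (x<x+ε 0<1) Unit.tt

  -- The endpoint is the supremum, or +∞ if there is no upper bound. An open set does not attain its
  -- supremum, hence the strict inequality; convexity fills the stretch between the chosen point and
  -- the endpoint.
  right-endpoint : ∀ {I} (interval : Interval I) → let x₀ = proj₁ (Interval.nonempty interval) in
    ∃[ β ] (∀ {s} → I s → s <ᴷ β) × (∀ {s} → x₀ ≤ s → s <ᴷ β → I s)
  right-endpoint {I} interval with dec (Satisfiable (UpperBound I))
  ... | no unbounded = nothing , (λ _ → Unit.tt) , λ {s} x₀≤s _ → by-contradiction λ s∉ →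
          unbounded (s , λ {y} y∈ → [ id , (λ s<y → contradiction (convex (proj₂ nonempty) y∈ x₀≤s (proj₁ s<y)) s∉) ]′
                                      (≤-<-total y s))
    where open Interval interval
  ... | yes bounded  = just β , below , λ {s} x₀≤s s<β → by-contradiction λ s∉ →
          <⇒≱ s<β (least s λ {y} y∈ →
            [ id , (λ s<y → contradiction (convex (proj₂ nonempty) y∈ x₀≤s (proj₁ s<y)) s∉) ]′ (≤-<-total y s))
    where
    open Interval interval
    lub = supremum I nonempty bounded
    β : Carrier
    β = proj₁ lub
    upper : UpperBound I β
    upper = proj₁ (proj₂ lub)
    least : ∀ u → UpperBound I u → β ≤ u
    least = proj₂ (proj₂ lub)
    below : ∀ {s} → I s → s < β
    below {s} s∈ = let ε , 0<ε , inI = isOpen s∈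
                       z , s<z , z<s+ε = dense (x<x+ε 0<ε)
                   in <-≤-trans s<z (upper (inI (<-trans (x-ε<x 0<ε) s<z) z<s+ε))

  -- The value 0 at +∞ makes an interval unbounded to the right jump there, so that it too has
  -- exactly one jump.
  valueAt : (Carrier → ℤ) → Key → ℤ
  valueAt g (just t) = g t
  valueAt g nothing  = 0ℤ

  private
    1-0 : ∀ {a b c} → a ≡ 1ℤ → b ≡ 0ℤ → c ≡ 1ℤ → a ℤ.- b ≡ c
    1-0 ≡.refl ≡.refl ≡.refl = ≡.refl
    0-0 : ∀ {a b c} → a ≡ 0ℤ → b ≡ 0ℤ → c ≡ 0ℤ → a ℤ.- b ≡ c
    0-0 ≡.refl ≡.refl ≡.refl = ≡.refl
    1-1 : ∀ {a b c} → a ≡ 1ℤ → b ≡ 1ℤ → c ≡ 0ℤ → a ℤ.- b ≡ c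
    1-1 ≡.refl ≡.refl ≡.refl = ≡.refl

  -- A jump is the left limit minus the value. Inside the interval both are 1; at its left endpoint
  -- and outside both are 0; at the right endpoint the limit is 1, while openness makes the value 0.
  interval-jump : ∀ {I} (interval : Interval I) κ → let β = proj₁ (right-endpoint interval) in
    Below κ (λ s → indicator (I s) ℤ.- valueAt (λ t → indicator (I t)) κ ≡ indicator (β ≈ᴷ κ))
  interval-jump {I} interval κ =
    let x₀ , x₀∈ = nonempty ; β , inside⇒< , <⇒inside = right-endpoint interval in jump x₀∈ β inside⇒< <⇒inside κ
    where
    open Interval interval
    jump : ∀ {x₀} → I x₀ → ∀ β → (∀ {s} → I s → s <ᴷ β) → (∀ {s} → x₀ ≤ s → s <ᴷ β → I s) → ∀ κ →
           Below κ (λ s → indicator (I s) ℤ.- valueAt (λ t → indicator (I t)) κ ≡ indicator (β ≈ᴷ κ))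
    jump {x₀} x₀∈ nothing  _   ⇒in nothing =
      x₀ , Unit.tt , λ x₀<s _ → 1-0 (indicator-yes (⇒in (proj₁ x₀<s) Unit.tt)) ≡.refl (indicator-yes nothing)
    jump {x₀} x₀∈ (just b) in⇒ _   nothing =
      b , Unit.tt , λ b<s _ → 0-0 (indicator-no λ s∈ → <⇒≱ b<s (proj₁ (in⇒ s∈))) ≡.refl (indicator-no λ ())
    jump {x₀} x₀∈ β in⇒ ⇒in (just t) with dec (I t) | dec (β ≈ᴷ just t) | ≤-<-total t x₀
    ... | yes t∈ | _ | _ = let ε , 0<ε , inI = isOpen t∈ in t - ε , x-ε<x 0<ε , λ t-ε<s s<t →
          1-1 (indicator-yes (inI t-ε<s (<-trans s<t (x<x+ε 0<ε)))) (indicator-yes t∈)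
              (indicator-no (λ β≈t → ≉ β≈t (in⇒ t∈)))
      where
      ≉ : ∀ {β} → β ≈ᴷ just t → ¬ (t <ᴷ β)
      ≉ (just b≈t) t<b = <-irrefl (sym b≈t) t<b
    ... | no t∉ | yes (just b≈t) | _ = x₀ , <-respʳ b≈t (in⇒ x₀∈) , λ x₀<s s<t →
          1-0 (indicator-yes (⇒in (proj₁ x₀<s) (<-respʳ (sym b≈t) s<t))) (indicator-no t∉) (indicator-yes (just b≈t))
    -- Here t lies to the left of the interval and may be its left endpoint; by convexity no point
    -- before t belongs to it.
    ... | no t∉ | no β≉t | inj₁ t≤x₀ = t - 1# , x-ε<x 0<1 , λ _ s<t →
          0-0 (indicator-no λ s∈ → t∉ (convex s∈ x₀∈ (proj₁ s<t) t≤x₀)) (indicator-no t∉) (indicator-no β≉t)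
    jump {x₀} x₀∈ nothing in⇒ ⇒in (just t) | no t∉ | no β≉t | inj₂ x₀<t =
      contradiction (⇒in (proj₁ x₀<t) Unit.tt) t∉
    jump {x₀} x₀∈ (just b) in⇒ ⇒in (just t) | no t∉ | no β≉t | inj₂ x₀<t =
      b , (≮⇒≥ (λ t<b → t∉ (⇒in (proj₁ x₀<t) t<b)) , λ b≈t → β≉t (just b≈t)) , λ b<s _ →
      0-0 (indicator-no λ s∈ → <⇒≱ b<s (proj₁ (in⇒ s∈))) (indicator-no t∉) (indicator-no β≉t)

  -- A formal integer combination of endpoints, repetitions allowed: `total-jump` is its
  -- augmentation and `jump-at` reads off a coefficient.
  Jumps : Set
  Jumps = List (ℤ × Key)

  total-jump : Jumps → ℤ
  total-jump []            = 0ℤ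
  total-jump ((c , _) ∷ L) = c ℤ.+ total-jump L

  jump-at : Key → Jumps → ℤ
  jump-at κ []            = 0ℤ
  jump-at κ ((c , β) ∷ L) = c ℤ.* indicator (β ≈ᴷ κ) ℤ.+ jump-at κ L

  total-++ : ∀ L M → total-jump (L ++ M) ≡ total-jump L ℤ.+ total-jump M
  total-++ []            M = ≡.sym (ℤ.+-identityˡ _)
  total-++ ((c , _) ∷ L) M = ≡.trans (≡.cong (ℤ._+_ c) (total-++ L M)) (≡.sym (ℤ.+-assoc c _ _))

  jump-at-++ : ∀ κ L M → jump-at κ (L ++ M) ≡ jump-at κ L ℤ.+ jump-at κ M
  jump-at-++ κ []            M = ≡.sym (ℤ.+-identityˡ _)
  jump-at-++ κ ((c , β) ∷ L) M = ≡.trans (≡.cong (ℤ._+_ (c ℤ.* indicator (β ≈ᴷ κ))) (jump-at-++ κ L M))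
      (≡.sym (ℤ.+-assoc (c ℤ.* indicator (β ≈ᴷ κ)) _ _))

  scale-jumps : ℤ → Jumps → Jumps
  scale-jumps a = List.map λ (c , β) → a ℤ.* c , β

  total-scale : ∀ a L → total-jump (scale-jumps a L) ≡ a ℤ.* total-jump L
  total-scale a []            = ≡.sym (ℤ.*-zeroʳ a)
  total-scale a ((c , _) ∷ L) = ≡.trans (≡.cong (ℤ._+_ (a ℤ.* c)) (total-scale a L)) (≡.sym (ℤ.*-distribˡ-+ a c _))

  jump-at-scale : ∀ κ a L → jump-at κ (scale-jumps a L) ≡ a ℤ.* jump-at κ L
  jump-at-scale κ a []            = ≡.sym (ℤ.*-zeroʳ a)
  jump-at-scale κ a ((c , β) ∷ L) =
    ≡.trans (≡.cong₂ ℤ._+_ (ℤ.*-assoc a c _) (jump-at-scale κ a L)) (≡.sym (ℤ.*-distribˡ-+ a _ _))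

  -- L collects the right endpoints of the intervals in the derivation with their coefficients. Its
  -- coefficients are the jumps of g and depend on g alone, while its total is v: this ties the
  -- derived value to the function.
  integral-jumps : ∀ {g v} → Integral Interval g v →
    ∃[ L ] total-jump L ≡ v × (∀ κ → Below κ (λ s → g s ℤ.- valueAt g κ ≡ jump-at κ L))
  integral-jumps (cell interval) = (1ℤ , proj₁ (right-endpoint interval)) ∷ [] , ≡.refl , λ κ →
    below-mono (λ eq → ≡.trans eq (≡.sym (≡.trans (ℤ.+-identityʳ _) (ℤ.*-identityˡ _)))) (interval-jump interval κ)
  integral-jumps none = [] , ≡.refl , λ { nothing → 0# , Unit.tt , λ _ _ → ≡.refl
                                        ; (just t) → t - 1# , x-ε<x 0<1 , λ _ _ → ≡.refl }
  integral-jumps (add {f} {g} F G) =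
    let L , L-total , L-jump = integral-jumps F
        M , M-total , M-jump = integral-jumps G
    in L ++ M , ≡.trans (total-++ L M) (≡.cong₂ ℤ._+_ L-total M-total) , λ κ →
       below-mono (λ {s} (p , q) → ≡.trans (≡.cong (ℤ._-_ (f s ℤ.+ g s)) (valueAt-+ κ))
                    (≡.trans (rearrange (f s) (g s) (valueAt f κ) (valueAt g κ))
                      (≡.trans (≡.cong₂ ℤ._+_ p q) (≡.sym (jump-at-++ κ L M)))))
         (below-∩ {κ} (L-jump κ) (M-jump κ))
    where
    valueAt-+ : ∀ κ → valueAt (λ x → f x ℤ.+ g x) κ ≡ valueAt f κ ℤ.+ valueAt g κ
    valueAt-+ (just _) = ≡.refl
    valueAt-+ nothing  = ≡.refl
    rearrange : ∀ a b c d → (a ℤ.+ b) ℤ.- (c ℤ.+ d) ≡ (a ℤ.- c) ℤ.+ (b ℤ.- d)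
    rearrange = solveℤ-∀
  integral-jumps (scale {f} c F) =
    let L , L-total , L-jump = integral-jumps F
    in scale-jumps c L , ≡.trans (total-scale c L) (≡.cong (ℤ._*_ c) L-total) , λ κ →
       below-mono (λ {s} p → ≡.trans (≡.cong (ℤ._-_ (c ℤ.* f s)) (valueAt-* κ))
                    (≡.trans (factor c (f s) (valueAt f κ))
                      (≡.trans (≡.cong (ℤ._*_ c) p) (≡.sym (jump-at-scale κ c L)))))
         (L-jump κ)
    where
    valueAt-* : ∀ κ → valueAt (λ x → c ℤ.* f x) κ ≡ c ℤ.* valueAt f κ
    valueAt-* (just _) = ≡.refl
    valueAt-* nothing  = ≡.sym (ℤ.*-zeroʳ c)
    factor : ∀ c a b → c ℤ.* a ℤ.- c ℤ.* b ≡ c ℤ.* (a ℤ.- b)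
    factor = solveℤ-∀
  integral-jumps (resp {f} {g} f≗g F) =
    let L , L-total , L-jump = integral-jumps F
    in L , L-total , λ κ →
       below-mono (λ {s} p → ≡.trans (≡.cong₂ ℤ._-_ (≡.sym (f≗g s)) (valueAt-cong κ)) p) (L-jump κ)
    where
    valueAt-cong : ∀ κ → valueAt g κ ≡ valueAt f κ
    valueAt-cong (just t) = ≡.sym (f≗g t)
    valueAt-cong nothing  = ≡.refl

  module _ (β : Key) where
    remove : Jumps → Jumps
    remove []            = []
    remove ((c , γ) ∷ L) with dec (γ ≈ᴷ β)
    ... | yes _ = remove L
    ... | no  _ = (c , γ) ∷ remove L

    remove-length : ∀ L → length (remove L) ℕ.≤ length L
    remove-length []            = ℕ.z≤n
    remove-length ((c , γ) ∷ L) with dec (γ ≈ᴷ β)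
    ... | yes _ = ℕ.m≤n⇒m≤1+n (remove-length L)
    ... | no  _ = ℕ.s≤s (remove-length L)

    total-remove : ∀ L → total-jump L ≡ jump-at β L ℤ.+ total-jump (remove L)
    total-remove []            = ≡.refl
    total-remove ((c , γ) ∷ L) with dec (γ ≈ᴷ β)
    ... | yes γ≈β = ≡.trans (≡.cong (ℤ._+_ c) (total-remove L))
                      (≡.trans (taken c (jump-at β L) _)
                        (≡.cong (λ i → c ℤ.* i ℤ.+ jump-at β L ℤ.+ _) (≡.sym (indicator-yes γ≈β))))
      where
      taken : ∀ c a b → c ℤ.+ (a ℤ.+ b) ≡ c ℤ.* 1ℤ ℤ.+ a ℤ.+ b
      taken = solveℤ-∀
    ... | no  γ≉β = ≡.trans (≡.cong (ℤ._+_ c) (total-remove L))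
                      (≡.trans (left c (jump-at β L) _)
                        (≡.cong (λ i → c ℤ.* i ℤ.+ jump-at β L ℤ.+ _) (≡.sym (indicator-no γ≉β))))
      where
      left : ∀ c a b → c ℤ.+ (a ℤ.+ b) ≡ c ℤ.* 0ℤ ℤ.+ a ℤ.+ (c ℤ.+ b)
      left = solveℤ-∀

    jump-at-remove : ∀ κ L → jump-at κ (remove L) ≡ 0ℤ ⊎ jump-at κ (remove L) ≡ jump-at κ L
    jump-at-remove κ L with dec (β ≈ᴷ κ)
    ... | yes β≈κ = inj₁ (gone L)
      where
      gone : ∀ L → jump-at κ (remove L) ≡ 0ℤ
      gone []            = ≡.refl
      gone ((c , γ) ∷ L) with dec (γ ≈ᴷ β)
      ... | yes _   = gone L
      ... | no  γ≉β = ≡.trans (≡.cong₂ (λ i a → c ℤ.* i ℤ.+ a)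
                        (indicator-no λ γ≈κ → γ≉β (Pointwise.trans trans γ≈κ (Pointwise.sym sym β≈κ))) (gone L))
                        (≡.trans (ℤ.+-identityʳ _) (ℤ.*-zeroʳ c))
    ... | no  β≉κ = inj₂ (kept L)
      where
      kept : ∀ L → jump-at κ (remove L) ≡ jump-at κ L
      kept []            = ≡.refl
      kept ((c , γ) ∷ L) with dec (γ ≈ᴷ β)
      ... | yes γ≈β = ≡.trans (kept L) (≡.sym (≡.trans
                        (≡.cong (λ i → c ℤ.* i ℤ.+ jump-at κ L)
                          (indicator-no λ γ≈κ → β≉κ (Pointwise.trans trans (Pointwise.sym sym γ≈β) γ≈κ)))
                        (≡.trans (≡.cong (ℤ._+ jump-at κ L) (ℤ.*-zeroʳ c)) (ℤ.+-identityˡ _))))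
      ... | no  _   = ≡.cong (ℤ._+_ (c ℤ.* indicator (γ ≈ᴷ κ))) (kept L)

  -- Grouping the entries by position, each group adds up to a coefficient, which is 0. The
  -- recursion is on a bound for the length, because `remove` deletes the head together with all
  -- later entries at its position.
  balanced⇒total-zero : ∀ L → (∀ κ → jump-at κ L ≡ 0ℤ) → total-jump L ≡ 0ℤ
  balanced⇒total-zero L = go (length L) L ℕ.≤-refl
    where
    go : ∀ n L → length L ℕ.≤ n → (∀ κ → jump-at κ L ≡ 0ℤ) → total-jump L ≡ 0ℤ
    go _       []              _          _        = ≡.refl
    go (suc n) L@((c , β) ∷ M) (ℕ.s≤s le) balanced = ≡.trans (total-remove β L)
      (≡.cong₂ ℤ._+_ (balanced β) (go n (remove β L) shorter
        (λ κ → [ id , (λ eq → ≡.trans eq (balanced κ)) ]′ (jump-at-remove β κ L))))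
      where
      shorter : length (remove β L) ℕ.≤ n
      shorter with dec (β ≈ᴷ β)
      ... | yes _  = ℕ.≤-trans (remove-length β M) le
      ... | no β≉β = contradiction (Pointwise.refl refl) β≉β

  -- The left limit of e 1[p] is 0 everywhere, so its only jump is -e, at p. Adding the entry (e, p)
  -- to the list of jumps of g therefore balances it, and the total e + v vanishes.
  integral-point-line : ∀ {g v} → Integral Interval g v → ∀ p e →
    (∀ t → g t ≡ e ℤ.* indicator (t ≈ p)) → v ≡ ℤ.- e
  integral-point-line {g} {v} G p e g≗ =
    let L , L-total , L-jump = integral-jumps G
        balanced : ∀ κ → jump-at κ ((e , just p) ∷ L) ≡ 0ℤ
        balanced = λ κ → let _ , q , r = below-witness {κ} (below-∩ {κ} (L-jump κ) (point-jump κ)) in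
          ≡.trans (≡.cong (ℤ._+_ (e ℤ.* indicator (just p ≈ᴷ κ))) (≡.trans (≡.sym q) r))
              (ℤ.+-inverseʳ (e ℤ.* indicator (just p ≈ᴷ κ)))
    in ≡.trans (≡.sym L-total) (inverse-unique e (total-jump L) (balanced⇒total-zero ((e , just p) ∷ L) balanced))
    where
    inverse-unique : ∀ a b → a ℤ.+ b ≡ 0ℤ → b ≡ ℤ.- a
    inverse-unique a b eq = ≡.trans (≡.sym (isolate a b)) (≡.trans (≡.cong (ℤ._- a) eq) (ℤ.+-identityˡ _))
      where
      isolate : ∀ a b → a ℤ.+ b ℤ.- a ≡ b
      isolate = solveℤ-∀
    off : ∀ {t} → ¬ (t ≈ p) → g t ≡ 0ℤ
    off {t} t≉p = ≡.trans (g≗ t) (≡.trans (≡.cong (ℤ._*_ e) (indicator-no t≉p)) (ℤ.*-zeroʳ e))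
    negate : ∀ {a b c} → a ≡ 0ℤ → b ≡ c → a ℤ.- b ≡ ℤ.- c
    negate ≡.refl ≡.refl = ℤ.+-identityˡ _
    point-jump : ∀ κ → Below κ (λ s → g s ℤ.- valueAt g κ ≡ ℤ.- (e ℤ.* indicator (just p ≈ᴷ κ)))
    point-jump nothing  = p , Unit.tt , λ p<s _ → negate (off λ s≈p → proj₂ p<s (sym s≈p))
      (≡.sym (≡.trans (≡.cong (ℤ._*_ e) (indicator-no λ ())) (ℤ.*-zeroʳ e)))
    point-jump (just t) =
      let u , u<t , away = avoid in
      u , u<t , λ u<s s<t → negate (off (away u<s s<t))
        (≡.trans (g≗ t) (≡.cong (ℤ._*_ e) (indicator-cong (just ∘ sym) λ { (just p≈t) → sym p≈t })))
      where
      avoid : ∃[ u ] u < t × (∀ {s} → u < s → s < t → ¬ (s ≈ p))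
      avoid with ≤-<-total t p
      ... | inj₁ t≤p = t - 1# , x-ε<x 0<1 , λ _ s<t s≈p → <-irrefl s≈p (<-≤-trans s<t t≤p)
      ... | inj₂ p<t = p , p<t , λ p<s _ s≈p → <-irrefl (sym s≈p) p<s

  -- Slices and Fubini's theorem

  slice : ∀ {d} → Pred (Vector Carrier (suc d)) 0ℓ → Carrier → Pred (Vector Carrier d) 0ℓ
  slice P t x = P (t ∷ᵛ x)

  slice-open : ∀ {d P} → Euclidean.Open ℝ (suc d) P → ∀ t → Euclidean.Open ℝ d (slice P t)
  slice-open openP t x∈ = let ε , 0<ε , ball = openP x∈ in
    ε , 0<ε , λ y∈ → ball λ { zero → x-ε<x 0<ε , x<x+ε 0<ε ; (suc i) → y∈ i }

  slice-convex : ∀ {d P} → Euclidean.Open ℝ (suc d) P → Convex P → ∀ t → Convex (slice {d} P t)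
  slice-convex openP convexP t x∈ y∈ {a} {b} 0≤a 0≤b a+b≈1 = open-resp openP
    (λ { zero → trans (sym (distribʳ t a b)) (trans (*-congʳ a+b≈1) (*-identityˡ t)) ; (suc i) → refl })
    (convexP x∈ y∈ 0≤a 0≤b a+b≈1)

  projection-interval : ∀ {d P} → ConvexOpen {suc d} P → Interval (λ t → ∃ (slice P t))
  projection-interval {d} {P} (openP , convexP , (x , x∈)) = record
    { isOpen   = λ (y , y∈) → let ε , 0<ε , ball = openP y∈ in ε , 0<ε , λ p q →
        y , ball λ { zero → p , q ; (suc i) → x-ε<x 0<ε , x<x+ε 0<ε }
    ; convex   = λ {s} {t} {z} (y , y∈) (w , w∈) s≤z z≤t →
        let a , b , 0≤a , 0≤b , a+b≈1 , z≈ = between s≤z z≤t in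
        (λ i → a * y i + b * w i) ,
        open-resp openP (λ { zero → sym z≈ ; (suc i) → refl }) (convexP y∈ w∈ 0≤a 0≤b a+b≈1)
    ; nonempty = x zero , tail x , open-resp openP (λ { zero → refl ; (suc i) → refl }) x∈
    }

  -- For one cell, the slice over t is empty or again a convex open cell, so its integral is 0 or 1;
  -- as a function of t this is the indicator of the projection, an interval. The other cases follow
  -- the derivation.
  fubini : ∀ {d f v} → Integral (ConvexOpen {suc d}) f v →
    ∃[ g ] Integral Interval g v × (∀ t → Integral (ConvexOpen {d}) (λ x → f (t ∷ᵛ x)) (g t))
  fubini {d} (cell {P} P-cell@(openP , convexP , _)) =
    (λ t → indicator (∃ (slice P t))) , cell (projection-interval P-cell) , slices
    where
    slices : ∀ t → Integral ConvexOpen (λ x → indicator (P (t ∷ᵛ x))) (indicator (∃ (slice P t)))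
    slices t with dec (∃ (slice P t))
    ... | yes w = ≡.subst (Integral ConvexOpen _) (≡.sym (indicator-yes w))
                    (cell (slice-open openP t , slice-convex openP convexP t , w))
    ... | no ¬w = ≡.subst (Integral ConvexOpen _) (≡.sym (indicator-no ¬w))
                    (resp (λ x → ≡.sym (indicator-no λ x∈ → ¬w (x , x∈))) none)
  fubini none = (λ _ → 0ℤ) , none , λ _ → none
  fubini (add F G) = let f , F₁ , F₂ = fubini F ; g , G₁ , G₂ = fubini G in
    (λ t → f t ℤ.+ g t) , add F₁ G₁ , λ t → add (F₂ t) (G₂ t)
  fubini (scale c F) = let f , F₁ , F₂ = fubini F in
    (λ t → c ℤ.* f t) , scale c F₁ , λ t → scale c (F₂ t)
  fubini (resp f≗g F) = let f , F₁ , F₂ = fubini F in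
    f , F₁ , λ t → resp (λ x → f≗g (t ∷ᵛ x)) (F₂ t)

  integral-zero-dim : ∀ {f v} → Integral (ConvexOpen {0}) f v → ∀ x → f x ≡ v
  integral-zero-dim (cell (openP , _ , (y , y∈))) x = indicator-yes (open-resp openP {y} {x} (λ ()) y∈)
  integral-zero-dim none         x = ≡.refl
  integral-zero-dim (add F G)    x = ≡.cong₂ ℤ._+_ (integral-zero-dim F x) (integral-zero-dim G x)
  integral-zero-dim (scale c F)  x = ≡.cong (ℤ._*_ c) (integral-zero-dim F x)
  integral-zero-dim (resp f≗g F) x = ≡.trans (≡.sym (f≗g x)) (integral-zero-dim F x)

  -- The slice of e 1[p] over t is a multiple of a point indicator, with factor e if t is the first
  -- coordinate of p and 0 otherwise. By induction it integrates to (-1)ᵈ e or 0, which is a point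
  -- function on the line, and the line contributes one more sign.
  integral-point : ∀ d {f v} → Integral (ConvexOpen {d}) f v → ∀ p e →
    (∀ x → f x ≡ e ℤ.* indicator (Euclidean._≋_ ℝ d x p)) → v ≡ -1ℤ ℤ.^ d ℤ.* e
  integral-point zero F p e f≗ = ≡.trans (≡.sym (integral-zero-dim F p)) (≡.trans (f≗ p)
    (≡.trans (≡.cong (ℤ._*_ e) (indicator-yes λ ())) (≡.trans (ℤ.*-identityʳ e) (≡.sym (ℤ.*-identityˡ e)))))
  integral-point (suc d) {f} {v} F p e f≗ =
    let g , F₁ , F₂ = fubini F in
    ≡.trans (integral-point-line F₁ (p zero) (-1ℤ ℤ.^ d ℤ.* e) λ t →
      ≡.trans (integral-point d (F₂ t) (tail p) (e ℤ.* indicator (t ≈ p zero)) λ x →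
        ≡.trans (f≗ (t ∷ᵛ x)) (≡.trans (≡.cong (ℤ._*_ e)
          (≡.trans (indicator-cong (λ eq → eq zero , eq ∘ suc)
              (λ (a , b) → λ { zero → a ; (suc i) → b i })) indicator-×))
          (≡.sym (ℤ.*-assoc e _ _))))
      (≡.sym (ℤ.*-assoc (-1ℤ ℤ.^ d) e _)))
    (sign (-1ℤ ℤ.^ d) e)
    where
    sign : ∀ a e → ℤ.- (a ℤ.* e) ≡ -1ℤ ℤ.* a ℤ.* e
    sign = solveℤ-∀

-- Sums over subsets and binomial identities

module Counting where
  open ≡ using (refl; sym; trans; cong; cong₂)
  open ℤSum using (∑-distrib-+; sum-cong-≋)

  sumOver : ∀ {A : Set} → (A → ℤ) → List A → ℤ
  sumOver F = foldr (λ a s → F a ℤ.+ s) 0ℤ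

  sumOver-++ : ∀ {A : Set} (F : A → ℤ) L M → sumOver F (L ++ M) ≡ sumOver F L ℤ.+ sumOver F M
  sumOver-++ F []      M = sym (ℤ.+-identityˡ _)
  sumOver-++ F (a ∷ L) M = trans (cong (ℤ._+_ (F a)) (sumOver-++ F L M)) (sym (ℤ.+-assoc (F a) _ _))

  sumOver-cong : ∀ {A : Set} {F G : A → ℤ} → (∀ a → F a ≡ G a) → ∀ L → sumOver F L ≡ sumOver G L
  sumOver-cong F≗G []      = refl
  sumOver-cong F≗G (a ∷ L) = cong₂ ℤ._+_ (F≗G a) (sumOver-cong F≗G L)

  sumOver-zero : ∀ {A : Set} {F : A → ℤ} → (∀ a → F a ≡ 0ℤ) → ∀ L → sumOver F L ≡ 0ℤ
  sumOver-zero F≗0 []      = refl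
  sumOver-zero F≗0 (a ∷ L) = cong₂ ℤ._+_ (F≗0 a) (sumOver-zero F≗0 L)

  sumOver-nat : ∀ {A : Set} (r : A → ℕ) L → sumOver (λ a → ℤ.+ r a) L ≡ ℤ.+ ℕList.sum (map r L)
  sumOver-nat r []      = refl
  sumOver-nat r (a ∷ L) = cong (ℤ._+_ (ℤ.+ r a)) (sumOver-nat r L)

  sumOfSize : ∀ {A : Set} → (A → ℕ) → (A → ℤ) → ℕ → List A → ℤ
  sumOfSize size F j L = sumOver F (filter (λ a → size a ℕ.≟ j) L)

  module _ {A : Set} where
    sumOfSize-++ : ∀ size (F : A → ℤ) j L M →
                   sumOfSize size F j (L ++ M) ≡ sumOfSize size F j L ℤ.+ sumOfSize size F j M
    sumOfSize-++ size F j L M = trans (cong (sumOver F) (List.filter-++ (λ a → size a ℕ.≟ j) L M))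
      (sumOver-++ F (filter (λ a → size a ℕ.≟ j) L) (filter (λ a → size a ℕ.≟ j) M))

    sumOfSize-map : ∀ {B : Set} size (F : B → ℤ) (g : A → B) j L →
                    sumOfSize size F j (map g L) ≡ sumOfSize (size ∘ g) (F ∘ g) j L
    sumOfSize-map size F g j []      = refl
    sumOfSize-map size F g j (a ∷ L) with does (size (g a) ℕ.≟ j)
    ... | true  = cong (ℤ._+_ (F (g a))) (sumOfSize-map size F g j L)
    ... | false = sumOfSize-map size F g j L

    sumOfSize-suc : ∀ size (F : A → ℤ) j L → sumOfSize (suc ∘ size) F (suc j) L ≡ sumOfSize size F j L
    sumOfSize-suc size F j []      = refl
    sumOfSize-suc size F j (a ∷ L) with does (size a ℕ.≟ j)
    ... | true  = cong (ℤ._+_ (F a)) (sumOfSize-suc size F j L)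
    ... | false = sumOfSize-suc size F j L

    sumOfSize-suc-zero : ∀ size (F : A → ℤ) L → sumOfSize (suc ∘ size) F 0 L ≡ 0ℤ
    sumOfSize-suc-zero size F []      = refl
    sumOfSize-suc-zero size F (a ∷ L) = sumOfSize-suc-zero size F L

  -- The indicator of T ⊆ P, by recursion on the vectors so that it computes when `subsets` is split
  -- at its first element.
  contained : ∀ {m} → Subset m → Subset m → ℤ
  contained []ₛ            []ₛ            = 1ℤ
  contained (outside ∷ₛ T) (_       ∷ₛ P) = contained T P
  contained (inside  ∷ₛ T) (inside  ∷ₛ P) = contained T P
  contained (inside  ∷ₛ T) (outside ∷ₛ P) = 0ℤ

  contained-⊤ : ∀ {m} (P : Subset m) → ∣ P ∣ ≢ m → contained Subset.⊤ P ≡ 0ℤ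
  contained-⊤ []ₛ            ≢m = contradiction refl ≢m
  contained-⊤ (outside ∷ₛ P) _ = refl
  contained-⊤ (inside  ∷ₛ P) ≢m = contained-⊤ P (≢m ∘ cong suc)

  contained-⊤-⊤ : ∀ m → contained {m} Subset.⊤ Subset.⊤ ≡ 1ℤ
  contained-⊤-⊤ zero    = refl
  contained-⊤-⊤ (suc m) = contained-⊤-⊤ m

  nC0≡1 : ∀ n → n C 0 ≡ 1
  nC0≡1 n = trans (nCk≡nC[n∸k] {0} {n} ℕ.z≤n) (nCn≡1 n)

  count-contained : ∀ m j (P : Subset m) →
                    sumOver (λ T → contained T P) (subsetsOfSize m j) ≡ ℤ.+ (∣ P ∣ C j)
  count-contained zero zero    []ₛ = refl
  count-contained zero (suc j) []ₛ = refl
  count-contained (suc m) j (b ∷ₛ P) =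
    trans (sumOfSize-++ ∣_∣ F j (map (outside ∷ₛ_) (subsets m)) (map (inside ∷ₛ_) (subsets m)))
      (trans (cong₂ ℤ._+_ (trans (sumOfSize-map ∣_∣ F (outside ∷ₛ_) j (subsets m)) (count-contained m j P))
                          (sumOfSize-map ∣_∣ F (inside ∷ₛ_) j (subsets m)))
        (with-first b j))
    where
    F : Subset (suc m) → ℤ
    F T = contained T (b ∷ₛ P)
    with-first : ∀ b j → ℤ.+ (∣ P ∣ C j) ℤ.+ sumOfSize (suc ∘ ∣_∣)
        (λ T → contained (inside ∷ₛ T) (b ∷ₛ P)) j (subsets m)
                         ≡ ℤ.+ (∣ b ∷ₛ P ∣ C j)
    with-first outside j = trans
      (cong (ℤ._+_ (ℤ.+ (∣ P ∣ C j)))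
          (sumOver-zero (λ _ → refl) (filter (λ T → suc ∣ T ∣ ℕ.≟ j) (subsets m)))) (ℤ.+-identityʳ (ℤ.+ (∣ P ∣ C j)))
    with-first inside zero = trans
      (cong₂ ℤ._+_ (cong ℤ.+_ (nC0≡1 ∣ P ∣)) (sumOfSize-suc-zero ∣_∣ (λ T → contained T P) (subsets m)))
      (cong ℤ.+_ (sym (nC0≡1 (suc ∣ P ∣))))
    with-first inside (suc j) = trans
      (cong (ℤ._+_ (ℤ.+ (∣ P ∣ C suc j)))
        (trans (sumOfSize-suc ∣_∣ (λ T → contained T P) j (subsets m)) (count-contained m j P)))
      (cong ℤ.+_ (trans (ℕ.+-comm (∣ P ∣ C suc j) (∣ P ∣ C j)) (nCk+nC[k+1]≡[n+1]C[k+1] ∣ P ∣ j)))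

  coefficient : ℕ → ℕ → ℕ → ℤ
  coefficient N n j = -1ℤ ℤ.^ (n ℕ.∸ j) ℤ.* ℤ.+ ((N ℕ.∸ j) C (n ℕ.∸ j))

  -- By upper negation the coefficient is the binomial coefficient of n − N − 1
  -- over n − j, so this is Vandermonde's convolution.
  binomialSum : ℕ → ℕ → ℕ → ℤ
  binomialSum N n p = ℤSum.sum {suc n} λ j → coefficient N n (toℕ j) ℤ.* ℤ.+ (p C toℕ j)

  -- Pascal's rule in p. Lowering N, n and j together leaves `coefficient` unchanged definitionally,
  -- so the terms with the smaller lower index form the sum for N and n.
  binomialSum-step : ∀ N n p → binomialSum (suc N) (suc n) (suc p) ≡ binomialSum (suc N) (suc n) p ℤ.+ binomialSum N n p
  binomialSum-step N n p = begin
    c₀ ℤ.* ℤ.+ (suc p C 0) ℤ.+ ℤSum.sum {suc n} (λ j → c j ℤ.* ℤ.+ (suc p C suc (toℕ j)))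
      ≡⟨ cong₂ ℤ._+_ (cong (λ b → c₀ ℤ.* ℤ.+ b) (trans (nC0≡1 (suc p)) (sym (nC0≡1 p))))
           (trans (sum-cong-≋ {suc n} pascal)
               (∑-distrib-+ {suc n} (λ j → c j ℤ.* ℤ.+ (p C suc (toℕ j))) (λ j → c j ℤ.* ℤ.+ (p C toℕ j)))) ⟩
    c₀ ℤ.* ℤ.+ (p C 0) ℤ.+ (ℤSum.sum {suc n} (λ j → c j ℤ.* ℤ.+ (p C suc (toℕ j))) ℤ.+ binomialSum N n p)
      ≡⟨ ℤ.+-assoc (c₀ ℤ.* ℤ.+ (p C 0)) _ _ ⟨
    binomialSum (suc N) (suc n) p ℤ.+ binomialSum N n p ∎
    where
    open ≡-Reasoning
    c₀ : ℤ
    c₀ = coefficient (suc N) (suc n) 0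
    c : Fin (suc n) → ℤ
    c j = coefficient N n (toℕ j)
    pascal : ∀ j → c j ℤ.* ℤ.+ (suc p C suc (toℕ j)) ≡ c j ℤ.* ℤ.+ (p C suc (toℕ j)) ℤ.+ c j ℤ.* ℤ.+ (p C toℕ j)
    pascal j = trans
      (cong (λ b → c j ℤ.* ℤ.+ b) (trans (sym (nCk+nC[k+1]≡[n+1]C[k+1] p (toℕ j))) (ℕ.+-comm (p C toℕ j) _)))
      (ℤ.*-distribˡ-+ (c j) (ℤ.+ (p C suc (toℕ j))) (ℤ.+ (p C toℕ j)))

  binomialSum-zero : ∀ N p → binomialSum N 0 p ≡ 1ℤ
  binomialSum-zero N p = cong₂ (λ a b → 1ℤ ℤ.* ℤ.+ a ℤ.* ℤ.+ b ℤ.+ 0ℤ) (nC0≡1 N) (nC0≡1 p)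

  -- The convolution has the value of the binomial coefficient of n - N - 1 + p over n, and upper
  -- negation makes it natural because p ≤ N. The induction on p stays clear of negative upper
  -- arguments.
  binomialSum-≤ : ∀ N n p → p ℕ.≤ N → binomialSum N n p ≡ -1ℤ ℤ.^ n ℤ.* ℤ.+ ((N ℕ.∸ p) C n)
  binomialSum-≤ N zero p _ = trans (binomialSum-zero N p) (cong (λ b → 1ℤ ℤ.* ℤ.+ b) (sym (nC0≡1 (N ℕ.∸ p))))
  binomialSum-≤ N (suc n) zero _ = begin
    c₀ ℤ.* ℤ.+ (0 C 0) ℤ.+ ℤSum.sum {suc n} (λ j → coefficient N (suc n) (suc (toℕ j)) ℤ.* ℤ.+ (0 C suc (toℕ j)))
      ≡⟨ cong₂ ℤ._+_ (ℤ.*-identityʳ c₀) (trans (sum-cong-≋ {suc n} vanish) (ℤSum.sum-replicate-zero (suc n))) ⟩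
    c₀ ℤ.+ 0ℤ ≡⟨ ℤ.+-identityʳ c₀ ⟩
    c₀ ∎
    where
    open ≡-Reasoning
    c₀ : ℤ
    c₀ = coefficient N (suc n) 0
    vanish : ∀ (j : Fin (suc n)) → coefficient N (suc n) (suc (toℕ j)) ℤ.* ℤ.+ (0 C suc (toℕ j)) ≡ 0ℤ
    vanish j = ℤ.*-zeroʳ (coefficient N (suc n) (suc (toℕ j)))
  binomialSum-≤ (suc N) (suc n) (suc p) (ℕ.s≤s p≤N) = begin
    binomialSum (suc N) (suc n) (suc p)
      ≡⟨ binomialSum-step N n p ⟩
    binomialSum (suc N) (suc n) p ℤ.+ binomialSum N n p
      ≡⟨ cong₂ ℤ._+_ (binomialSum-≤ (suc N) (suc n) p (ℕ.m≤n⇒m≤1+n p≤N)) (binomialSum-≤ N n p p≤N) ⟩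
    -1ℤ ℤ.* s ℤ.* ℤ.+ ((suc N ℕ.∸ p) C suc n) ℤ.+ s ℤ.* ℤ.+ (a C n)
      ≡⟨ cong (λ b → -1ℤ ℤ.* s ℤ.* ℤ.+ b ℤ.+ s ℤ.* ℤ.+ (a C n))
           (trans (cong (_C suc n) (ℕ.+-∸-assoc 1 p≤N)) (sym (nCk+nC[k+1]≡[n+1]C[k+1] a n))) ⟩
    -1ℤ ℤ.* s ℤ.* (ℤ.+ (a C n) ℤ.+ ℤ.+ (a C suc n)) ℤ.+ s ℤ.* ℤ.+ (a C n)
      ≡⟨ cancel s (ℤ.+ (a C n)) (ℤ.+ (a C suc n)) ⟩
    -1ℤ ℤ.* s ℤ.* ℤ.+ (a C suc n) ∎
    where
    open ≡-Reasoning
    s : ℤ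
    s = -1ℤ ℤ.^ n
    a : ℕ
    a = N ℕ.∸ p
    cancel : ∀ s x y → -1ℤ ℤ.* s ℤ.* (x ℤ.+ y) ℤ.+ s ℤ.* x ≡ -1ℤ ℤ.* s ℤ.* y
    cancel = solveℤ-∀

  -- For p = N + 1 the convolution is the binomial coefficient of n over n. The closed form for p ≤
  -- N does not extend here, since truncated subtraction would make its upper argument 0 instead of
  -- -1.
  binomialSum-top : ∀ N n → n ℕ.≤ N → binomialSum N n (suc N) ≡ 1ℤ
  binomialSum-top N       zero    _             = binomialSum-zero N (suc N)
  binomialSum-top (suc N) (suc n) (ℕ.s≤s n≤N) = trans (binomialSum-step N n (suc N)) (cong₂ ℤ._+_
    (trans (binomialSum-≤ (suc N) (suc n) (suc N) ℕ.≤-refl)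
      (trans (cong (λ b → -1ℤ ℤ.^ suc n ℤ.* ℤ.+ b)
               (cong (_C suc n) (ℕ.n∸n≡0 N)))
             (ℤ.*-zeroʳ (-1ℤ ℤ.^ suc n))))
    (binomialSum-top N n n≤N))

-- From indicator functions to numbers of cells

module Regions (em : ExcludedMiddle (lsuc 0ℓ)) (ℝ : CompleteOrderedField) where
  open CompleteOrderedField ℝ hiding (zero)
  open Reals em ℝ
  open Topology em ℝ
  open Integration em ℝ
  open Counting

  module _ {X : Set} {Admissible : Pred X 0ℓ → Set} where
    integral-sumOver : ∀ {A : Set} {F : A → X → ℤ} {v : A → ℤ} → (∀ a → Integral Admissible (F a) (v a)) →
                       ∀ L → Integral Admissible (λ x → sumOver (λ a → F a x) L) (sumOver v L)
    integral-sumOver integrals []      = none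
    integral-sumOver integrals (a ∷ L) = add (integrals a) (integral-sumOver integrals L)

    integral-sum : ∀ {r} {F : Fin r → X → ℤ} {v : Fin r → ℤ} → (∀ i → Integral Admissible (F i) (v i)) →
                   Integral Admissible (λ x → ℤSum.sum (λ i → F i x)) (ℤSum.sum v)
    integral-sum {zero}  integrals = none
    integral-sum {suc r} integrals = add (integrals zero) (integral-sum (integrals ∘ suc))

    integral-cells : ∀ {r} {P : Fin r → Pred X 0ℓ} → (∀ i → Admissible (P i)) →
                     Integral Admissible (λ x → ℤSum.sum (λ i → indicator (P i x))) (ℤ.+ r)
    integral-cells {zero}  _          = none
    integral-cells {suc r} admissible = add (cell (admissible zero)) (integral-cells (admissible ∘ suc))

  sum-indicator : ∀ {r} {P : Fin r → Set} → (∀ {i j} → P i → P j → i ≡ j) →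
                  ℤSum.sum (λ i → indicator (P i)) ≡ indicator (∃ P)
  sum-indicator {zero}      _        = ≡.sym (indicator-no λ ())
  sum-indicator {suc r} {P} disjoint with dec (P zero)
  ... | yes p0 = ≡.trans (≡.cong₂ ℤ._+_ (indicator-yes p0)
                   (≡.trans (sum-indicator (λ p q → Fin.suc-injective (disjoint p q)))
                            (indicator-no λ (i , p) → Fin.0≢1+n (disjoint p0 p))))
                   (≡.sym (indicator-yes (zero , p0)))
  ... | no ¬p0 = ≡.trans (≡.cong₂ ℤ._+_ (indicator-no ¬p0) (sum-indicator (λ p q → Fin.suc-injective (disjoint p q))))
                   (≡.trans (ℤ.+-identityˡ _) (indicator-cong (λ (i , p) → suc i , p)
                     λ { (zero , p) → contradiction p ¬p0 ; (suc i , p) → i , p }))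

  integral-partition : ∀ {d X r} → OpenPartition {d} X r → Integral ConvexOpen (λ x → indicator (X x)) (ℤ.+ r)
  integral-partition π = resp (λ x → ≡.trans (sum-indicator disjoint) (indicator-cong (sound ∘ proj₂) covers))
    (integral-cells λ i → isOpen i , isConvex i , nonempty i)
    where open OpenPartition π

  mask : ∀ {m} → (Fin m → Set) → Subset m
  mask {zero}  y = []ₛ
  mask {suc m} y = does (dec (y zero)) ∷ₛ mask (y ∘ suc)

  indicator-⋂ : ∀ {m} (T : Subset m) (y : Fin m → Set) →
                indicator (∀ i → i ∈ₛ T → y i) ≡ contained T (mask y)
  indicator-⋂ []ₛ            y = indicator-yes λ _ ()
  indicator-⋂ (outside ∷ₛ T) y = ≡.trans
    (indicator-cong (λ p i i∈ → p (suc i) (there i∈)) (λ p → λ { (suc i) (there i∈) → p i i∈ }))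
    (indicator-⋂ T (y ∘ suc))
  indicator-⋂ (inside  ∷ₛ T) y with dec (y zero)
  ... | yes y0 = ≡.trans
    (indicator-cong (λ p i i∈ → p (suc i) (there i∈)) (λ p → λ { zero _ → y0 ; (suc i) (there i∈) → p i i∈ }))
    (indicator-⋂ T (y ∘ suc))
  ... | no ¬y0 = indicator-no λ p → ¬y0 (p zero here)

  mask-none : ∀ {m} {y : Fin m → Set} → (∀ i → ¬ y i) → ∣ mask y ∣ ≡ 0
  mask-none {zero}      ¬y = ≡.refl
  mask-none {suc m} {y} ¬y with dec (y zero)
  ... | yes y0 = contradiction y0 (¬y zero)
  ... | no  _  = mask-none (¬y ∘ suc)

  -- The complement of `mask y`, enumerated injectively, which is the form in which `Simple` takes a
  -- family of different units.
  exceptions : ∀ {m} (y : Fin m → Set) → ∃[ j ] Σ (Fin j → Fin m) λ u →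
               Injective _≡_ _≡_ u × (∀ s → ¬ y (u s)) × ∣ mask y ∣ ℕ.+ j ≡ m
  exceptions {zero}  y = 0 , (λ ()) , (λ { {()} }) , (λ ()) , ≡.refl
  exceptions {suc m} y with dec (y zero) | exceptions (y ∘ suc)
  ... | yes _  | j , u , injective , ¬y , eq =
    j , suc ∘ u , injective ∘ Fin.suc-injective , ¬y , ≡.cong suc eq
  ... | no ¬y0 | j , u , injective , ¬y , eq =
    suc j , (zero ∷ᵛ (suc ∘ u))
    , (λ { {zero} {zero} _ → ≡.refl ; {suc s} {suc t} eq → ≡.cong suc (injective (Fin.suc-injective eq)) })
    , (λ { zero → ¬y0 ; (suc s) → ¬y s }) , ≡.trans (ℕ.+-suc _ j) (≡.cong suc eq)

  -- The left-hand side of the theorem minus its alternating sum, for an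
  -- arbitrary set function in place of r.
  defect : ∀ N → ℕ → (Subset (suc N) → ℤ) → ℤ
  defect N n F = F Subset.⊤ ℤ.+ -1ℤ ℤ.* ℤSum.sum {suc n} λ j →
                 coefficient N n (toℕ j) ℤ.* sumOver F (subsetsOfSize (suc N) (toℕ j))

  defect-cong : ∀ N n {F G} → (∀ S → F S ≡ G S) → defect N n F ≡ defect N n G
  defect-cong N n {F} {G} F≗G = ≡.cong₂ (λ a b → a ℤ.+ -1ℤ ℤ.* b) (F≗G Subset.⊤)
    (ℤSum.sum-cong-≋ {suc n} λ j → ≡.cong (ℤ._*_ (coefficient N n (toℕ j)))
        (sumOver-cong F≗G (subsetsOfSize (suc N) (toℕ j))))

  -- `defect` is linear in its set function; its subtraction is written as a multiple by `-1ℤ` so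
  -- that `add` and `scale` apply directly.
  integral-defect : ∀ {X Admissible} N n {F : Subset (suc N) → X → ℤ} {v} →
                    (∀ S → Integral Admissible (F S) (v S)) →
                    Integral Admissible (λ x → defect N n (λ S → F S x)) (defect N n v)
  integral-defect N n integrals = add (integrals Subset.⊤) (scale -1ℤ (integral-sum {r = suc n} λ j →
    scale (coefficient N n (toℕ j)) (integral-sumOver integrals (subsetsOfSize (suc N) (toℕ j)))))

  module _ (N n : ℕ) (P : Subset (suc N)) where
    private
      p : ℕ
      p = ∣ P ∣

    defect-binomial : defect N n (λ T → contained T P) ≡ contained Subset.⊤ P ℤ.+ -1ℤ ℤ.* binomialSum N n p
    defect-binomial = ≡.cong (λ s → contained Subset.⊤ P ℤ.+ -1ℤ ℤ.* s)
      (ℤSum.sum-cong-≋ {suc n} λ j → ≡.cong (ℤ._*_ (coefficient N n (toℕ j))) (count-contained (suc N) (toℕ j) P))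

    defect-empty : p ≡ 0 → defect N n (λ T → contained T P) ≡ -1ℤ ℤ.^ suc n ℤ.* ℤ.+ (N C n)
    defect-empty p≡0 = ≡.trans defect-binomial (≡.trans
      (≡.cong₂ (λ a b → a ℤ.+ -1ℤ ℤ.* b)
        (contained-⊤ P λ p≡1+N → ℕ.0≢1+n (≡.trans (≡.sym p≡0) p≡1+N))
        (≡.trans (≡.cong (binomialSum N n) p≡0) (binomialSum-≤ N n 0 ℕ.z≤n)))
      (rearrange (-1ℤ ℤ.^ n) (ℤ.+ (N C n))))
      where
      rearrange : ∀ s b → 0ℤ ℤ.+ -1ℤ ℤ.* (s ℤ.* b) ≡ -1ℤ ℤ.* s ℤ.* b
      rearrange = solveℤ-∀

    -- If all units are smooth, both terms are 1. Otherwise the full set is not contained in P, and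
    -- the closed form vanishes because N - p < n.
    defect-large : n ℕ.≤ N → suc N ℕ.≤ p ℕ.+ n → defect N n (λ T → contained T P) ≡ 0ℤ
    defect-large n≤N 1+N≤p+n with p ℕ.≟ suc N
    ... | yes p≡1+N = ≡.trans defect-binomial (≡.cong₂ (λ a b → a ℤ.+ -1ℤ ℤ.* b)
      (≡.trans (≡.cong (contained Subset.⊤) (Subset.∣p∣≡n⇒p≡⊤ {p = P} p≡1+N)) (contained-⊤-⊤ (suc N)))
      (≡.trans (≡.cong (binomialSum N n) p≡1+N) (binomialSum-top N n n≤N)))
    ... | no  p≢1+N = ≡.trans defect-binomial (≡.cong₂ (λ a b → a ℤ.+ -1ℤ ℤ.* b)
      (contained-⊤ P p≢1+N)
      (≡.trans (binomialSum-≤ N n p p≤N)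
        (≡.trans (≡.cong (λ b → -1ℤ ℤ.^ n ℤ.* ℤ.+ b) (k>n⇒nCk≡0 N∸p<n)) (ℤ.*-zeroʳ (-1ℤ ℤ.^ n)))))
      where
      p≤N : p ℕ.≤ N
      p≤N = ℕ.≤-pred (ℕ.≤∧≢⇒< (Subset.∣p∣≤n P) p≢1+N)
      N∸p<n : N ℕ.∸ p ℕ.< n
      N∸p<n = ℕ.+-cancelˡ-< p (N ℕ.∸ p) n (≡.subst (ℕ._< p ℕ.+ n) (≡.sym (ℕ.m+[n∸m]≡n p≤N)) 1+N≤p+n)

-- The arrangement of m = N + 1 units

module MaxoutRegions (em : ExcludedMiddle (lsuc 0ℓ)) (ℝ : CompleteOrderedField) (n N : ℕ) (k : Fin (suc N) → ℕ)
  (A : ∀ i → Fin (k i) → Euclidean.LinearFunction ℝ (suc n)) where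
  open CompleteOrderedField ℝ hiding (zero)
  open Reals em ℝ
  open Topology em ℝ
  open Integration em ℝ
  open Regions em ℝ
  open Counting
  open MaxoutUnit em ℝ n
  open Euclidean ℝ (suc n)
  open MaxoutArrangement ℝ A

  B : ∀ i → Fin (k i) → Point → Carrier
  B i c = ⟦ A i c ⟧

  linear-B : ∀ i c → Linear (B i c)
  linear-B i c = linear (A i c)

  NonSmoothAt : Fin (suc N) → Pred Point 0ℓ
  NonSmoothAt i = NonSmooth (B i) (linear-B i)

  opaque
    nonsmooth⇒atom : ∀ {i x} → NonSmoothAt i x → ∃[ a ] ∃[ b ] IsAtom i a b × H i a b x
    nonsmooth⇒atom {i} {x} nonsmooth =
      a , b , ((λ a≡b → distinct (≡.subst (λ c → ∀ x → ⟦ A i a ⟧ x ≈ ⟦ A i c ⟧ x) a≡b λ _ → refl)) ,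
          facet-codimension (B i) (linear-B i) F) , antisym (active-b a) (active-a b) , active-a
      where
      F : Facet (B i) (linear-B i) x
      F = facet (B i) (linear-B i) nonsmooth
      open Facet F

    smooth⇔unsupported : ∀ S → (λ x → ∀ i → i ∈ₛ S → ∁ (NonSmoothAt i) x) ≐ ∁ (support S)
    smooth⇔unsupported S =
      (λ smooth (i , i∈S , a , b , (a≢b , codim) , x∈) →
        smooth i i∈S (codimension-one⇒nonsmooth (B i) (linear-B i) a≢b codim x∈))
      , λ unsupported i i∈S nonsmooth → unsupported (i , i∈S , nonsmooth⇒atom nonsmooth)

  module _ (2≤k : ∀ i → 2 ℕ.≤ k i) where
    opaque
      regions : ∀ S → ∃ (OpenPartition (∁ (support S)))
      regions S =
        let r , π = open-partition-⋂ (λ i → smooth-partition (B i) (linear-B i)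
                (fromℕ< (ℕ.≤-trans (ℕ.s≤s ℕ.z≤n) (2≤k i)))) S
        in r , open-partition-resp (smooth⇔unsupported S) π

    r : Subset (suc N) → ℕ
    r S = proj₁ (regions S)

    smoothUnits : Point → Subset (suc N)
    smoothUnits x = mask (λ i → ¬ NonSmoothAt i x)

    indicator-unsupported : ∀ S x → indicator (∁ (support S) x) ≡ contained S (smoothUnits x)
    indicator-unsupported S x = ≡.trans
      (≡.sym (indicator-cong (proj₁ (smooth⇔unsupported S)) (proj₂ (smooth⇔unsupported S))))
      (indicator-⋂ S (λ i → ¬ NonSmoothAt i x))

    module _ (n≤N : n ℕ.≤ N) (notAllEqual : ∀ i → NotAllEqual i) (simple : Simple) where
      -- All linear functions vanish at the origin, hence all are active there, and two of each unit
      -- differ.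
      nonsmooth-at-zero : ∀ {x} → x ≋ 0ᵛ → ∀ i → NonSmoothAt i x
      nonsmooth-at-zero x≋0 i =
        let a , a≁ = not-all (notAllEqual i)
            b , a≁b = not-all a≁
        in a , b , a≁b , active a , active b
        where
        active : ∀ a → Active (B i) (linear-B i) _ a
        active = zero-active (B i) (linear-B i) x≋0

      -- Choosing an atom through x for each of the j non-smooth units, simplicity gives an
      -- intersection of codimension j, as it contains x and so is not the origin alone. For the
      -- same reason its dimension is positive, whence j ≤ n.
      many-smooth : ∀ {x} → ¬ (x ≋ 0ᵛ) → suc N ℕ.≤ ∣ smoothUnits x ∣ ℕ.+ n
      many-smooth {x} x≉0 with exceptions (λ i → ¬ NonSmoothAt i x)
      ... | j , u , injective , nonsmooth , count =
        ≡.subst (ℕ._≤ ∣ smoothUnits x ∣ ℕ.+ n) count (ℕ.+-monoʳ-≤ ∣ smoothUnits x ∣ (ℕ.≮⇒≥ few))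
        where
        atoms : ∀ s → ∃[ a ] ∃[ b ] IsAtom (u s) a b × H (u s) a b x
        atoms s = nonsmooth⇒atom (by-contradiction (nonsmooth s))
        few : ¬ (n ℕ.< j)
        few n<j with simple j u injective (proj₁ ∘ atoms) (proj₁ ∘ proj₂ ∘ atoms) (proj₁ ∘ proj₂ ∘ proj₂ ∘ atoms)
        ... | inj₁ (⊆0 , _) = x≉0 (⊆0 (proj₂ ∘ proj₂ ∘ proj₂ ∘ atoms))
        -- Dimension 0: x is in the span of the intersection, hence a combination of the empty
        -- basis, that is, the origin.
        ... | inj₂ (zero  , (b , _ , _ , spanning) , _) =
          x≉0 (proj₂ (spanning (1 , (λ _ → 1#) , (λ _ → x) , (λ _ → proj₂ ∘ proj₂ ∘ proj₂ ∘ atoms)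
            , λ t → sym (trans (+-identityʳ _) (*-identityˡ _)))))
        ... | inj₂ (suc e , _ , e+j≡n) = ℕ.<⇒≱ n<j (ℕ.≤-trans (ℕ.m≤n+m j e) (ℕ.≤-reflexive (ℕ.suc-injective e+j≡n)))

      e : ℤ
      e = -1ℤ ℤ.^ suc n ℤ.* ℤ.+ (N C n)

      defect-pointwise : ∀ x → defect N n (λ S → indicator (∁ (support S) x))
                               ≡ e ℤ.* indicator (x ≋ 0ᵛ)
      defect-pointwise x with dec (x ≋ 0ᵛ)
      ... | yes x≋0 = ≡.trans (defect-cong N n (λ S → indicator-unsupported S x)) (≡.trans
        (defect-empty N n (smoothUnits x)
            (mask-none {y = λ i → ¬ NonSmoothAt i x} λ i smooth → smooth (nonsmooth-at-zero x≋0 i)))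
        (≡.sym (≡.trans (≡.cong (ℤ._*_ e) (indicator-yes x≋0)) (ℤ.*-identityʳ e))))
      ... | no x≉0 = ≡.trans (defect-cong N n (λ S → indicator-unsupported S x)) (≡.trans
        (defect-large N n (smoothUnits x) n≤N (many-smooth x≉0))
        (≡.sym (≡.trans (≡.cong (ℤ._*_ e) (indicator-no x≉0)) (ℤ.*-zeroʳ e))))

      -- The defect of the indicators is e times the point indicator of the origin. Integrating over
      -- ℝⁿ⁺¹ multiplies e by (-1)ⁿ⁺¹, which cancels the sign that e carries.
      defect-regions : defect N n (λ S → ℤ.+ r S) ≡ ℤ.+ (N C n)
      defect-regions = ≡.trans
        (integral-point (suc n) (integral-defect N n (λ S → integral-partition (proj₂ (regions S)))) 0ᵛ e
            defect-pointwise)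
        (≡.trans (≡.sym (ℤ.*-assoc (-1ℤ ℤ.^ suc n) (-1ℤ ℤ.^ suc n) (ℤ.+ (N C n))))
          (≡.trans (≡.cong (ℤ._* ℤ.+ (N C n)) (square (suc n))) (ℤ.*-identityˡ _)))
        where
        square : ∀ n → -1ℤ ℤ.^ n ℤ.* -1ℤ ℤ.^ n ≡ 1ℤ
        square zero    = ≡.refl
        square (suc n) = ≡.trans (cancel (-1ℤ ℤ.^ n)) (square n)
          where
          cancel : ∀ s → (-1ℤ ℤ.* s) ℤ.* (-1ℤ ℤ.* s) ≡ s ℤ.* s
          cancel = solveℤ-∀

      region-count : ℤ.+ r Subset.⊤ ≡ ℤ.+ (N C n) ℤ.+ ℤSum.sum {suc n} λ j →
                     coefficient N n (toℕ j) ℤ.* ℤ.+ ℕList.sum (List.map r (subsetsOfSize (suc N) (toℕ j)))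
      region-count = ≡.trans (isolate (ℤ.+ r Subset.⊤) alternating)
        (≡.cong₂ ℤ._+_ defect-regions (ℤSum.sum-cong-≋ {suc n} λ j →
          ≡.cong (ℤ._*_ (coefficient N n (toℕ j))) (sumOver-nat r (subsetsOfSize (suc N) (toℕ j)))))
        where
        alternating : ℤ
        alternating = ℤSum.sum {suc n} λ j → coefficient N n (toℕ j) ℤ.* sumOver (λ S → ℤ.+ r S)
            (subsetsOfSize (suc N) (toℕ j))
        isolate : ∀ a s → a ≡ a ℤ.+ -1ℤ ℤ.* s ℤ.+ s
        isolate = solveℤ-∀

      cardinality : ∀ S → NumberOfRegions S (r S)
      cardinality S = components-cardinality (proj₂ (regions S))

open import Axiom.ExcludedMiddle using (ExcludedMiddle)
open import Data.Fin.Base using (Fin; toℕ)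
open import Data.Fin.Subset using (Subset; ⊤)
open import Data.Integer.Base using (+_; -1ℤ; _+_; _*_; _^_)
open import Data.Integer.Properties using (+-*-semiring)
open import Algebra.Properties.Semiring.Sum +-*-semiring using (sum⁺-syntax)
open import Data.List.Base using (map)
open import Data.Nat.Base using (ℕ; suc; _∸_; _≤_)
open import Data.Nat.Combinatorics using (_C_)
open import Data.Nat.ListAction using (sum)
open import Data.Product.Base using (Σ; _×_)
open import Level using (0ℓ) renaming (suc to lsuc)
open import Relation.Binary.PropositionalEquality using (_≡_)

theorem6p3 : ExcludedMiddle (lsuc 0ℓ) →
  (ℝ : CompleteOrderedField) →
  (n m : ℕ) (k : Fin m → ℕ) (A : ∀ i → Fin (k i) → Euclidean.LinearFunction ℝ (suc n)) →
  let open MaxoutArrangement ℝ A in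
  suc n ≤ m →
  (∀ i → 2 ≤ k i) →
  (∀ i → NotAllEqual i) →
  Simple →
  Σ (Subset m → ℕ) λ r →
    (∀ S → NumberOfRegions S (r S)) ×
    + r ⊤ ≡ + ((m ∸ 1) C n)
            + ∑[ j ≤ n ] (-1ℤ ^ (n ∸ toℕ j)
                          * + ((m ∸ 1 ∸ toℕ j) C (n ∸ toℕ j))
                          * + sum (map r (subsetsOfSize m (toℕ j))))
theorem6p3 em ℝ n (suc N) k A (ℕ.s≤s n≤N) 2≤k notAllEqual simple =
  r 2≤k , cardinality 2≤k n≤N notAllEqual simple , region-count 2≤k n≤N notAllEqual simple
  where open MaxoutRegions em ℝ n N k A
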